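{- Let $\ell\ge3$. The crystal $B(\Lambda_0)$ is isomorphic to $B(\Lambda_0)^L$.
   Context: An isomorphism here is a bijection between the sets of nodes which preserves the arrows together with their labels $i\in\{0,\dots,\ell-1\}$ in both directions (and the weight, where the weight of a partition $\lambda$ is $\Lambda_0-\sum_i c_i\alpha_i$ with $c_i$ the number of boxes of $\lambda$ of residue $i$). The position $(a,b)$ (row $a$, rows numbered downward; column $b$) has residue $b-a\bmod\ell$. A box of $\lambda$ of residue $i$ whose removal leaves a partition is a removable $i$-box (marked $-$); a position of residue $i$ not in $\lambda$ whose addition gives a partition is an addable $i$-box (marked $+$). Classical crystal $B(\Lambda_0)$ of $\widehat{\mathfrak{sl}_\ell}$: the nodes are the $\ell$-regular partitions (those without $\ell$ or more equal nonzero parts). The $i$-signature is the word of $+$'s and $-$'s read from the bottom row to the top row; after repeatedly deleting adjacent pairs $-+$ one gets $+\cdots+-\cdots-$. $\widetilde f_i\lambda$ is $\lambda$ with the box of the rightmost remaining $+$ added (or $0$ if there is none). There is an $i$-arrow $\lambda\to\mu$ iff $\widetilde f_i\lambda=\mu$. Ladder crystal $B(\Lambda_0)^L$: the ladder of $(a,b)$ is the set of positions $(c,d)$, $c,d\ge1$, with $c-a=(\ell-1)(b-d)$; all its positions have the same residue, and it is an $i$-ladder if that residue is $i$. Ladders are ordered left to right, i.e. by increasing value of $a+(\ell-1)(b-1)$. The ladder $i$-signature of a partition is the word of $+$'s and $-$'s read from leftmost to rightmost $i$-ladder, and from top to bottom on each ladder; repeatedly delete adjacent pairs $-+$. $\widehat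 f_i\lambda$ is $\lambda$ with the box of the rightmost remaining $+$ added (or $0$ if there is none). The nodes of $B(\Lambda_0)^L$ are the partitions obtained from the empty partition $\emptyset$ by applying finite sequences of the operators $\widehat f_i$, and there is an $i$-arrow $\lambda\to\mu$ iff $\widehat f_i\lambda=\mu$. -}

module Defs where

open import Data.Empty using (⊥-elim)
open import Data.Fin as Fin using (Fin; fromℕ<)
import Data.Fin.Properties as Fin
open import Data.Integer as ℤ using (ℤ; +_; 0ℤ; 1ℤ)
open import Data.Integer.DivMod using (_%ℕ_; n%ℕd<d)
open import Data.List using (List; []; _∷_; length; map; filter; mapMaybe;
  concatMap; upTo; reverse; foldr; last)
open import Data.List.Extrema.Nat using (max)
open import Data.List.Relation.Unary.All using (All; []; _∷_; all?)
open import Data.List.Relation.Unary.Linked using (Linked; []; [-]; _∷_; linked?)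
open import Data.Maybe using (Maybe; just; nothing; _>>=_)
import Data.Maybe as Maybe
open import Data.Nat
open import Data.Nat.Properties
open import Data.Product using (Σ; ∃; _×_; _,_; proj₁; proj₂)
open import Data.Sign using (Sign)
import Data.Sign.Properties as Sign
open import Data.Sum using (_⊎_; inj₁; inj₂)
import Data.Vec.Functional as Vector
open import Function using (_∘_; _⇔_; mk⇔; Bijection; Equivalence)
open import Relation.Binary using (Setoid)
import Relation.Binary.Construct.On as On
open import Relation.Binary.PropositionalEquality
open import Relation.Nullary using (¬_; Dec; yes; no; does; recompute; dec⇒maybe)
open import Relation.Nullary.Decidable using (_×-dec_; map′)
open import Data.Bool using (if_then_else_)

IsPartition : List ℕ → Set
IsPartition xs = Linked _≥_ xs × All (0 <_) xs

-- The proof is irrelevant, so _≡_ on partitions is equality of the parts.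
record Partition : Set where
  constructor ⟨_,_⟩
  field
    parts        : List ℕ
    .isPartition : IsPartition parts

open Partition public

∅ : Partition
∅ = ⟨ [] , ([] , []) ⟩

-- Rows and columns are counted from 0: (a , b) is the position in row a + 1
-- and column b + 1 of the usual convention, so every element of ℕ × ℕ is one.
Position : Set
Position = ℕ × ℕ

nth : List ℕ → ℕ → ℕ
nth []       _       = 0
nth (x ∷ _)  zero    = x
nth (_ ∷ xs) (suc a) = nth xs a

row : Partition → ℕ → ℕ
row μ = nth (parts μ)

infix 4 _∈_ _∉_

_∈_ : Position → Partition → Set
(a , b) ∈ μ = b < row μ a

_∉_ : Position → Partition → Set
x ∉ μ = ¬ x ∈ μ

-- ν is the diagram of μ with the position x added, respectively with the box x
-- removed.
IsAdd : Partition → Position → Partition → Set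
IsAdd μ x ν = x ∉ μ × (∀ y → y ∈ ν ⇔ (y ∈ μ ⊎ y ≡ x))

IsRemove : Partition → Position → Partition → Set
IsRemove μ x ν = x ∈ μ × (∀ y → y ∈ ν ⇔ (y ∈ μ × y ≢ x))

Addable : Partition → Position → Set
Addable μ x = ∃ λ ν → IsAdd μ x ν

Removable : Partition → Position → Set
Removable μ x = ∃ λ ν → IsRemove μ x ν

-- Addability and removability are decidable.  The notions above are all that
-- matters for the definitions further down, not how they are decided.

Antitone : (ℕ → ℕ) → Set
Antitone g = ∀ n → g (suc n) ≤ g n

nth-antitone : ∀ {xs} → Linked _≥_ xs → Antitone (nth xs)
nth-antitone []        n       = z≤n
nth-antitone [-]       n       = z≤n
nth-antitone (p ∷ ps)  zero    = p
nth-antitone (p ∷ ps)  (suc n) = nth-antitone ps n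

row-antitone : ∀ μ → Antitone (row μ)
row-antitone ⟨ xs , p ⟩ =
  nth-antitone (proj₁ (recompute (linked? _≥?_ xs ×-dec all? (0 <?_) xs) p))

nth-end : ∀ xs c → length xs ≤ c → nth xs c ≡ 0
nth-end []       c       _       = refl
nth-end (x ∷ xs) (suc c) (s≤s p) = nth-end xs c p

antitone-zero : ∀ g → Antitone g → g 0 ≡ 0 → ∀ n → g n ≡ 0
antitone-zero g anti z zero    = z
antitone-zero g anti z (suc n) =
  n≤0⇒n≡0 (≤-trans (anti n) (≤-reflexive (antitone-zero g anti z n)))

ofRows : ℕ → (ℕ → ℕ) → List ℕ
ofRows zero    g = []
ofRows (suc n) g with g 0
... | zero  = []
... | suc k = suc k ∷ ofRows n (g ∘ suc)

nth-ofRows : ∀ n g → Antitone g → g n ≡ 0 → ∀ c → nth (ofRows n g) c ≡ g c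
nth-ofRows zero    g anti z c = sym (antitone-zero g anti z c)
nth-ofRows (suc n) g anti z c with g 0 in eq
... | zero  = sym (antitone-zero g anti eq c)
nth-ofRows (suc n) g anti z zero    | suc k = sym eq
nth-ofRows (suc n) g anti z (suc c) | suc k =
  nth-ofRows n (g ∘ suc) (anti ∘ suc) z c

linked-ofRows : ∀ n g → Antitone g → Linked _≥_ (ofRows n g)
linked-ofRows zero    g anti = []
linked-ofRows (suc n) g anti with g 0 in eq
... | zero  = []
... | suc k = extend n (g ∘ suc) (subst (g 1 ≤_) eq (anti 0))
                (linked-ofRows n (g ∘ suc) (anti ∘ suc))
  where
  extend : ∀ n h {m} → h 0 ≤ m → Linked _≥_ (ofRows n h) →
           Linked _≥_ (m ∷ ofRows n h)
  extend zero    h le ps = [-]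
  extend (suc n) h le ps with h 0
  ... | zero  = [-]
  ... | suc _ = le ∷ ps

positive-ofRows : ∀ n g → All (0 <_) (ofRows n g)
positive-ofRows zero    g = []
positive-ofRows (suc n) g with g 0
... | zero  = []
... | suc k = z<s ∷ positive-ofRows n (g ∘ suc)

replace : (ℕ → ℕ) → ℕ → ℕ → ℕ → ℕ
replace g a v c with c ≟ a
... | yes _ = v
... | no  _ = g c

replace-antitone : ∀ g a v → Antitone g → g (suc a) ≤ v →
                   (∀ c → a ≡ suc c → v ≤ g c) → Antitone (replace g a v)
replace-antitone g a v anti lo hi n with suc n ≟ a | n ≟ a
... | yes p    | yes q    = ⊥-elim (1+n≢n (trans p (sym q)))
... | yes p    | no  _    = hi n (sym p)
... | no  _    | yes refl = lo
... | no  _    | no  _    = anti n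

withRow : (μ : Partition) (a v : ℕ) → row μ (suc a) ≤ v →
          (∀ c → a ≡ suc c → v ≤ row μ c) →
          Σ Partition λ ν → ∀ c → row ν c ≡ replace (row μ) a v c
withRow μ a v lo hi =
  ⟨ ofRows n g , (linked-ofRows n g anti , positive-ofRows n g) ⟩ ,
  nth-ofRows n g anti end
  where
  n = suc a + length (parts μ)
  g = replace (row μ) a v
  anti : Antitone g
  anti = replace-antitone (row μ) a v (row-antitone μ) lo hi
  end : g n ≡ 0
  end with n ≟ a
  ... | yes p = ⊥-elim (m≢1+m+n a (sym p))
  ... | no  _ = nth-end (parts μ) n (m≤n+m (length (parts μ)) (suc a))

AddCriterion RemoveCriterion : Partition → Position → Set
AddCriterion    μ (a , b) = b ≡ row μ a × (∀ c → a ≡ suc c → b < row μ c)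
RemoveCriterion μ (a , b) = suc b ≡ row μ a × row μ (suc a) ≤ b

addCriterion? : ∀ μ x → Dec (AddCriterion μ x)
addCriterion? μ (zero  , b) = (b ≟ row μ 0) ×-dec yes (λ _ ())
addCriterion? μ (suc a , b) =
  (b ≟ row μ (suc a)) ×-dec
  map′ (λ lt c → λ { refl → lt }) (λ h → h a refl) (b <? row μ a)

removeCriterion? : ∀ μ x → Dec (RemoveCriterion μ x)
removeCriterion? μ (a , b) = (suc b ≟ row μ a) ×-dec (row μ (suc a) ≤? b)

criterion⇒addable : ∀ μ x → AddCriterion μ x → Addable μ x
criterion⇒addable μ (a , b) (refl , hi) = ν , <-irrefl refl , λ (c , d) → spec c d
  where
  new = withRow μ a (suc b) (m≤n⇒m≤1+n (row-antitone μ a)) hi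
  ν = proj₁ new
  spec : ∀ c d → (d < row ν c) ⇔ (d < row μ c ⊎ (c , d) ≡ (a , b))
  spec c d with eq ← proj₂ new c | c ≟ a
  ... | no c≢a rewrite eq = mk⇔ inj₁ λ where
    (inj₁ p)    → p
    (inj₂ refl) → ⊥-elim (c≢a refl)
  ... | yes refl rewrite eq = mk⇔ to from
    where
    to : d < suc b → d < b ⊎ (a , d) ≡ (a , b)
    to p with m≤n⇒m<n∨m≡n (≤-pred p)
    ... | inj₁ q    = inj₁ q
    ... | inj₂ refl = inj₂ refl
    from : d < b ⊎ (a , d) ≡ (a , b) → d < suc b
    from (inj₁ p)    = m<n⇒m<1+n p
    from (inj₂ refl) = n<1+n d

addable⇒criterion : ∀ μ x → Addable μ x → AddCriterion μ x
addable⇒criterion μ (a , b) (ν , x∉μ , spec) =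
  ≤-antisym (full b x∈ν below) (≮⇒≥ x∉μ) , above
  where
  open Equivalence
  x∈ν : b < row ν a
  x∈ν = from (spec (a , b)) (inj₂ refl)
  below : ∀ d → d < b → d < row μ a
  below d d<b with to (spec (a , d)) (<-trans d<b x∈ν)
  ... | inj₁ p    = p
  ... | inj₂ refl = ⊥-elim (<-irrefl refl d<b)
  full : ∀ b → b < row ν a → (∀ d → d < b → d < row μ a) → b ≤ row μ a
  full zero    _ _ = z≤n
  full (suc d) _ h = h d (n<1+n d)
  above : ∀ c → a ≡ suc c → b < row μ c
  above c refl with to (spec (c , b)) (<-≤-trans x∈ν (row-antitone ν c))
  ... | inj₁ p = p
  ... | inj₂ ()

criterion⇒removable : ∀ μ x → RemoveCriterion μ x → Removable μ x
criterion⇒removable μ (a , b) (eq₀ , lo) =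
  ν , ≤-reflexive eq₀ , λ (c , d) → spec c d
  where
  hi : ∀ c → a ≡ suc c → b ≤ row μ c
  hi c refl = ≤-trans (≤-trans (n≤1+n b) (≤-reflexive eq₀)) (row-antitone μ c)
  new = withRow μ a b lo hi
  ν = proj₁ new
  spec : ∀ c d → (d < row ν c) ⇔ (d < row μ c × (c , d) ≢ (a , b))
  spec c d with eq ← proj₂ new c | c ≟ a
  ... | no c≢a rewrite eq = mk⇔ (λ p → p , λ { refl → c≢a refl }) proj₁
  ... | yes refl rewrite eq = mk⇔ to from
    where
    to : d < b → d < row μ a × (a , d) ≢ (a , b)
    to p = subst (d <_) eq₀ (m<n⇒m<1+n p) , λ { refl → <-irrefl refl p }
    from : d < row μ a × (a , d) ≢ (a , b) → d < b
    from (p , ne) with m≤n⇒m<n∨m≡n (≤-pred (subst (d <_) (sym eq₀) p))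
    ... | inj₁ q    = q
    ... | inj₂ refl = ⊥-elim (ne refl)

removable⇒criterion : ∀ μ x → Removable μ x → RemoveCriterion μ x
removable⇒criterion μ (a , b) (ν , x∈μ , spec) =
  ≤-antisym x∈μ (≮⇒≥ right) , ≮⇒≥ down
  where
  open Equivalence
  x∉ν : ¬ b < row ν a
  x∉ν p = proj₂ (to (spec (a , b)) p) refl
  right : ¬ suc b < row μ a
  right p = x∉ν (<-trans (n<1+n b)
    (from (spec (a , suc b)) (p , λ e → 1+n≢n (cong proj₂ e))))
  down : ¬ b < row μ (suc a)
  down p = x∉ν (<-≤-trans
    (from (spec (suc a , b)) (p , λ e → 1+n≢n (cong proj₁ e)))
    (row-antitone ν a))

addable? : ∀ μ x → Dec (Addable μ x)
addable? μ x =
  map′ (criterion⇒addable μ x) (addable⇒criterion μ x) (addCriterion? μ x)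

removable? : ∀ μ x → Dec (Removable μ x)
removable? μ x =
  map′ (criterion⇒removable μ x) (removable⇒criterion μ x) (removeCriterion? μ x)

add : Partition → Position → Maybe Partition
add μ x = Maybe.map proj₁ (dec⇒maybe (addable? μ x))

Word : Set
Word = List (Sign × Position)

pattern plus  x = (Sign.+ , x)
pattern minus x = (Sign.- , x)

push : Sign × Position → Word → Word
push (minus _) (plus _ ∷ w) = w
push s         w            = s ∷ w

-- Deletes adjacent pairs − + until none is left: the tail of the word is reduced
-- first, after which only a − in front of it can create a new such pair.
reduce : Word → Word
reduce = foldr push []

-- Adds the box of the rightmost + of the reduced word; nothing stands for 0.
addRightmost : Partition → Word → Maybe Partition
addRightmost μ w =
  last (filter (λ s → proj₁ s Sign.≟ Sign.+) (reduce w)) >>= λ s → add μ (proj₂ s)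

module _ (ℓ : ℕ) .{{_ : NonZero ℓ}} where

  residue : Position → Fin ℓ
  residue (a , b) = fromℕ< (n%ℕd<d (+ b ℤ.- + a) ℓ)

  mark : Fin ℓ → Partition → Position → Maybe (Sign × Position)
  mark i μ x with residue x Fin.≟ i | removable? μ x | addable? μ x
  ... | no  _ | _     | _     = nothing
  ... | yes _ | yes _ | _     = just (minus x)
  ... | yes _ | no  _ | yes _ = just (plus x)
  ... | yes _ | no  _ | no  _ = nothing

  -- From top to bottom.  Every box and every addable position (a , b) of μ has
  -- a ≤ length (parts μ) and b ≤ row μ a.  A row contains at most one mark when
  -- ℓ ≥ 2, as its removable box and its addable position are adjacent.
  marks : Fin ℓ → Partition → Word
  marks i μ = mapMaybe (mark i μ)
    (concatMap (λ a → map (a ,_) (upTo (suc (row μ a)))) (upTo (suc (length (parts μ)))))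

  signature : Fin ℓ → Partition → Word
  signature i μ = reverse (marks i μ)

  f̃ : Fin ℓ → Partition → Maybe Partition
  f̃ i μ = addRightmost μ (signature i μ)

  -- The condition c − a = (ℓ − 1)(b − d) for two positions (a , b), (c , d) to be
  -- on the same ladder says that they have the same value of a + (ℓ − 1) b.
  -- With rows and columns counted from 1 that value is a + (ℓ − 1)(b − 1) at the
  -- position represented by (a ∸ 1 , b ∸ 1), whence the suc.
  ladder : Position → ℕ
  ladder (a , b) = suc a + (ℓ ∸ 1) * b

  ladderSignature : Fin ℓ → Partition → Word
  ladderSignature i μ = concatMap (λ n → filter (λ s → ladder (proj₂ s) ≟ n) w)
    (upTo (suc (max 0 (map (λ s → ladder (proj₂ s)) w))))
    where w = marks i μ

  f̂ : Fin ℓ → Partition → Maybe Partition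
  f̂ i μ = addRightmost μ (ladderSignature i μ)

  IsRegular : Partition → Set
  IsRegular μ = ∀ k → length (filter (_≟ k) (parts μ)) < ℓ

  data Reachable : Partition → Set where
    empty : Reachable ∅
    step  : ∀ i {μ ν} → Reachable μ → f̂ i μ ≡ just ν → Reachable ν

  boxes : Partition → List Position
  boxes μ = concatMap (λ a → map (a ,_) (upTo (row μ a))) (upTo (length (parts μ)))

  content : Fin ℓ → Partition → ℕ
  content i μ = length (filter (λ x → residue x Fin.≟ i) (boxes μ))

  -- Coordinates with respect to the basis Λ₀, α₀, …, α_{ℓ-1} of the dual of the
  -- Cartan subalgebra (which has dimension ℓ + 1 as it includes the derivation).
  Weight : Set
  Weight = Fin (suc ℓ) → ℤ

  basis : Fin (suc ℓ) → Weight
  basis j k = if does (j Fin.≟ k) then 1ℤ else 0ℤ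

  Λ₀ : Weight
  Λ₀ = basis Fin.zero

  α : Fin ℓ → Weight
  α i = basis (Fin.suc i)

  weight : Partition → Weight
  weight μ j =
    Λ₀ j ℤ.- Vector.foldr ℤ._+_ 0ℤ (λ i → + content i μ ℤ.* α i j)

  record Crystal : Set₁ where
    field
      IsNode : Partition → Set
      f      : Fin ℓ → Partition → Maybe Partition

    -- Nodes are equal when the underlying partitions are.
    nodes : Setoid _ _
    nodes = On.setoid {B = Σ Partition IsNode} (setoid Partition) proj₁

    Node : Set
    Node = Setoid.Carrier nodes

    Arrow : Fin ℓ → Node → Node → Set
    Arrow i x y = f i (proj₁ x) ≡ just (proj₁ y)

  B⟨Λ₀⟩ : Crystal
  B⟨Λ₀⟩ = record { IsNode = IsRegular ; f = f̃ }

  B⟨Λ₀⟩ᴸ : Crystal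
  B⟨Λ₀⟩ᴸ = record { IsNode = Reachable ; f = f̂ }

  record Isomorphism (C D : Crystal) : Set where
    private
      module C = Crystal C
      module D = Crystal D
    field
      bijection : Bijection C.nodes D.nodes
    open Bijection bijection public using (to)
    field
      arrows  : ∀ i x y → C.Arrow i x y ⇔ D.Arrow i (to x) (to y)
      weights : ∀ x → weight (proj₁ (to x)) ≗ weight (proj₁ x)

{-# OPTIONS --safe #-}
-- Both crystals are governed by the numbers of boxes on the ladders.  Put
--   T n = #(+ on ladders ≤ n) − #(− on ladders < n)
-- for the marks of residue i.  Inclusion–exclusion along the rim shows that T only
-- depends on the numbers of boxes on the ladders.  If a word runs along the ladders,
-- with the + of a ladder before its −, then the rightmost + of its reduction lies on
-- the first ladder n where T attains its maximum, provided that this is positive.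
-- The ladder signature of a partition has this form if there is no hook of length
-- ℓ times its arm length, and the usual signature has it if the partition is regular.
-- Both classes are closed under adding the good box and under its inverse, which
-- removes a box from the last ladder where T is maximal.  Hence the two operators
-- preserve the relation of having the same number of boxes on each ladder, and
-- removing boxes one by one shows that this relation is a bijection of the nodes.

module Submission where

open import Defs
open import Data.Nat using (ℕ; NonZero; _≤_)
open import Data.Empty using (⊥; ⊥-elim)
open import Data.Fin as Fin using (Fin)
import Data.Fin.Properties as Fin
open import Data.Integer as ℤ using (ℤ; +_; 0ℤ; 1ℤ; -1ℤ)
open import Data.Integer.DivMod using (_%ℕ_; _/ℕ_; n%ℕd<d; a≡a%ℕn+[a/ℕn]*n)
import Data.Integer.Properties as ℤ
import Data.Integer.Tactic.RingSolver as ℤ-Solver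
open import Data.List using (List; []; _∷_; _++_; _∷ʳ_; length; map; mapMaybe;
  concatMap; upTo; filter; foldr; last; reverse)
open import Data.List.Extrema.Nat using (max; xs≤max)
open import Data.List.Membership.Propositional using (find; lose) renaming (_∈_ to _∈ˡ_)
open import Data.List.Membership.Propositional.Properties using (∈-concatMap⁺;
  ∈-map⁺; ∈-upTo⁺; ∈-insert; ∈-++⁻)
open import Data.List.Properties using (∷-injective; filter-none; filter-all;
  filter-accept; filter-reject; unfold-reverse; upTo-∷ʳ; concatMap-++; ++-identityʳ)
open import Data.List.Relation.Binary.Permutation.Propositional using (_↭_; ↭-sym;
  ↭-trans; ↭-reflexive; module PermutationReasoning)
import Data.List.Relation.Binary.Permutation.Propositional as ↭
open import Data.List.Relation.Binary.Permutation.Propositional.Properties using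
  (∈-resp-↭; All-resp-↭; ↭-reverse; ++⁺) renaming (shift to ↭-shift)
open import Data.List.Relation.Unary.All as All using (All; []; _∷_)
import Data.List.Relation.Unary.All.Properties as All
open import Data.List.Relation.Unary.AllPairs as AllPairs using (AllPairs; []; _∷_)
import Data.List.Relation.Unary.AllPairs.Properties as AllPairs
open import Data.List.Relation.Unary.Any as Any using (Any; here; there)
open import Data.List.Relation.Unary.Linked using (Linked; []; [-]; _∷_; linked?)
open import Data.Maybe using (Maybe; just; nothing; maybe′)
open import Data.Nat as ℕ using (zero; suc; _+_; _*_; _<_; _≥_; _≤?_; _<?_; _≟_; z≤n; s≤s)
open import Data.Nat.DivMod using (_%_; _/_; m≡m%n+[m/n]*n; m%n<n)
import Data.Nat.Properties as ℕ
import Data.Nat.Tactic.RingSolver as ℕ-Solver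
open import Data.Product using (∃; ∃₂; _×_; _,_; proj₁; proj₂)
open import Data.Sign using (Sign)
import Data.Sign.Properties as Sign
open import Data.Sum using (_⊎_; inj₁; inj₂)
open import Data.Vec.Functional.Relation.Binary.Pointwise.Properties using (foldr-cong)
open import Function using (_∘_; id; flip; mk⇔; Equivalence)
open import Relation.Binary using (tri<; tri≈; tri>)
open import Relation.Binary.PropositionalEquality
open import Relation.Nullary using (¬_; Dec; yes; no; recompute)
open import Relation.Nullary.Decidable using (_×-dec_)
open import Relation.Unary using (Decidable)

-- Deleting a pair -+ removes a dip in the prefix heights and keeps their maximum, so the surviving
-- + are the letters at which a new positive record is reached. This is how maxima of T enter.
-- Counting only the - of earlier ladders makes T n the highest point within ladder n. As ladders of
-- equal residue are at least ℓ apart, a - on ladder p can be counted at p + ℓ instead, the ladder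
-- of the corner diagonally outside the box. T thereby becomes a signed sum over the corners of the
-- rim. The bijection is not given by a formula. Adding a box on ladder n lowers T by 0, 1 and 2
-- before, on and after n (for ladders of that residue), which turns a first maximum into a last one
-- and back. The box numbers therefore reveal the ladder of the last box. Which box of that ladder
-- it is depends on the reading order: the topmost + for the classical signature, the lowest for the
-- ladder signature; membership in the class makes it unique. Ladder nodes are generated by
-- definition. For regular partitions it has to be shown that removing boxes never gets stuck.

private variable
  A B : Set

-- Sums over lists and indicators

∑ : (A → ℤ) → List A → ℤ
∑ f = foldr (λ x s → f x ℤ.+ s) 0ℤ

∑-++ : ∀ (f : A → ℤ) xs ys → ∑ f (xs ++ ys) ≡ ∑ f xs ℤ.+ ∑ f ys
∑-++ f []       ys = sym (ℤ.+-identityˡ _)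
∑-++ f (x ∷ xs) ys =
  trans (cong (ℤ._+_ (f x)) (∑-++ f xs ys)) (sym (ℤ.+-assoc (f x) _ _))

∑-↭ : ∀ (f : A → ℤ) {xs ys} → xs ↭ ys → ∑ f xs ≡ ∑ f ys
∑-↭ f ↭.refl         = refl
∑-↭ f (↭.prep x p)   = cong (ℤ._+_ (f x)) (∑-↭ f p)
∑-↭ f (↭.trans p q)  = trans (∑-↭ f p) (∑-↭ f q)
∑-↭ f {_ ∷ _ ∷ xs} {_ ∷ _ ∷ ys} (↭.swap x y p) = begin
  f x ℤ.+ (f y ℤ.+ ∑ f xs) ≡⟨ ℤ.+-assoc (f x) (f y) _ ⟨
  f x ℤ.+ f y ℤ.+ ∑ f xs   ≡⟨ cong₂ ℤ._+_ (ℤ.+-comm (f x) (f y)) (∑-↭ f p) ⟩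
  f y ℤ.+ f x ℤ.+ ∑ f ys   ≡⟨ ℤ.+-assoc (f y) (f x) _ ⟩
  f y ℤ.+ (f x ℤ.+ ∑ f ys) ∎
  where open ≡-Reasoning

∑-cong : ∀ {f g : A → ℤ} {xs} → All (λ x → f x ≡ g x) xs → ∑ f xs ≡ ∑ g xs
∑-cong []       = refl
∑-cong (p ∷ ps) = cong₂ ℤ._+_ p (∑-cong ps)

∑-mono : ∀ {f g : A → ℤ} {xs} → All (λ x → f x ℤ.≤ g x) xs → ∑ f xs ℤ.≤ ∑ g xs
∑-mono []       = ℤ.≤-refl
∑-mono (p ∷ ps) = ℤ.+-mono-≤ p (∑-mono ps)

∑-mono-< : ∀ {f g : A → ℤ} {xs x} → All (λ x → f x ℤ.≤ g x) xs →
           x ∈ˡ xs → f x ℤ.< g x → ∑ f xs ℤ.< ∑ g xs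
∑-mono-< (p ∷ ps) (here refl) lt = ℤ.+-mono-<-≤ lt (∑-mono ps)
∑-mono-< (p ∷ ps) (there i)   lt = ℤ.+-mono-≤-< p (∑-mono-< ps i lt)

∑-zero : ∀ {f : A → ℤ} {xs} → All (λ x → f x ≡ 0ℤ) xs → ∑ f xs ≡ 0ℤ
∑-zero []       = refl
∑-zero (p ∷ ps) = cong₂ ℤ._+_ p (∑-zero ps)

ind : Dec A → ℤ
ind (yes _) = 1ℤ
ind (no  _) = 0ℤ

ind-yes : (p : Dec A) → A → ind p ≡ 1ℤ
ind-yes (yes _) a = refl
ind-yes (no ¬a) a = ⊥-elim (¬a a)

ind-no : (p : Dec A) → ¬ A → ind p ≡ 0ℤ
ind-no (yes a) ¬a = ⊥-elim (¬a a)
ind-no (no _)  ¬a = refl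

ind-⇔ : (p : Dec A) (q : Dec B) → (A → B) → (B → A) → ind p ≡ ind q
ind-⇔ (yes a) q f g = sym (ind-yes q (f a))
ind-⇔ (no ¬a) q f g = sym (ind-no q (¬a ∘ g))

ind-nonneg : (p : Dec A) → 0ℤ ℤ.≤ ind p
ind-nonneg (yes _) = ℤ.+≤+ z≤n
ind-nonneg (no  _) = ℤ.≤-refl

AllPairs-middle : ∀ {R : A → A → Set} u {x v} → AllPairs R (u ++ x ∷ v) →
                  All (λ s → R s x) u × All (R x) v
AllPairs-middle []      (r ∷ _)  = [] , r
AllPairs-middle (_ ∷ u) (r ∷ rs) with before , after ← AllPairs-middle u rs =
  All.head (All.++⁻ʳ u r) ∷ before , after

-- Signature words

marked : Sign → List Position → Word
marked s = map (s ,_)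

sgn : Sign × Position → ℤ
sgn (plus  _) = 1ℤ
sgn (minus _) = -1ℤ

height : Word → ℤ
height = ∑ sgn

Below : ℤ → Word → Set
Below k w = ∀ u v → u ++ v ≡ w → height u ℤ.≤ k

FirstPeak : ℤ → Position → Word → Set
FirstPeak k x w = ∃₂ λ u v → u ++ plus x ∷ v ≡ w × height u ℤ.+ 1ℤ ≡ k ×
  (∀ u₁ u₂ → u₁ ++ u₂ ≡ u → height u₁ ℤ.< k)

Below-∷ : ∀ s {w k k′} → Below k w → sgn s ℤ.+ k ℤ.≤ k′ → 0ℤ ℤ.≤ k′ →
          Below k′ (s ∷ w)
Below-∷ s b le nonneg []       v refl = nonneg
Below-∷ s b le nonneg (_ ∷ u) v refl =
  ℤ.≤-trans (ℤ.+-monoʳ-≤ (sgn s) (b u v refl)) le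

-- The positivity premise concerns the empty prefix: its height 0 has to stay below the shifted peak
-- for that peak to be the first.
FirstPeak-∷ : ∀ s {w k x} → FirstPeak k x w → 0ℤ ℤ.< sgn s ℤ.+ k →
              FirstPeak (sgn s ℤ.+ k) x (s ∷ w)
FirstPeak-∷ s {k = k} (u , v , eq , top , first) pos =
  s ∷ u , v , cong (s ∷_) eq ,
  trans (ℤ.+-assoc (sgn s) _ _) (cong (ℤ._+_ (sgn s)) top) , first′
  where
  first′ : ∀ u₁ u₂ → u₁ ++ u₂ ≡ s ∷ u → height u₁ ℤ.< sgn s ℤ.+ k
  first′ []        u₂ e    = pos
  first′ (_ ∷ u₁) u₂ refl = ℤ.+-monoʳ-< (sgn s) (first u₁ u₂ refl)

-- The heights of the prefixes of w attain their maximum for the first time right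
-- after the rightmost + of the reduced word.
record Reduction (w r : Word) : Set where
  field
    pluses minuses : List Position
    shape : r ≡ marked Sign.+ pluses ++ marked Sign.- minuses
    below : Below (+ length pluses) w
    peak  : ∀ {x} → last pluses ≡ just x → FirstPeak (+ length pluses) x w

reduction : ∀ w → Reduction w (reduce w)
reduction [] = record
  { pluses = [] ; minuses = [] ; shape = refl
  ; below = λ { [] _ _ → ℤ.≤-refl } ; peak = λ () }
reduction (s ∷ w) with reduce w | reduction w
reduction (plus y ∷ w) | r | R = record
  { pluses = y ∷ pluses ; minuses = minuses ; shape = cong (plus y ∷_) shape
  ; below = Below-∷ (plus y) below ℤ.≤-refl (ℤ.+≤+ z≤n)
  ; peak = peak′ pluses peak }
  where
  open Reduction R
  peak′ : ∀ ps {x} → (∀ {x} → last ps ≡ just x → FirstPeak (+ length ps) x w) →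
          last (y ∷ ps) ≡ just x → FirstPeak (+ suc (length ps)) x (plus y ∷ w)
  peak′ []      pk refl =
    [] , w , refl , refl , λ { [] _ _ → ℤ.+<+ ℕ.z<s }
  peak′ (_ ∷ _) pk eq   = FirstPeak-∷ (plus y) (pk eq) (ℤ.+<+ ℕ.z<s)
reduction (minus y ∷ w) | _ | record { pluses = [] ; minuses = ms ; shape = refl
                                     ; below = below } = record
  { pluses = [] ; minuses = y ∷ ms ; shape = push-minus ms
  ; below = Below-∷ (minus y) below ℤ.-≤+ ℤ.≤-refl ; peak = λ () }
  where
  push-minus : ∀ ms → push (minus y) (marked Sign.- ms) ≡ marked Sign.- (y ∷ ms)
  push-minus []      = refl
  push-minus (_ ∷ _) = refl
reduction (minus y ∷ w) | _ | record { pluses = p ∷ ps ; minuses = ms ; shape = refl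
                                     ; below = below ; peak = peak } = record
  { pluses = ps ; minuses = ms ; shape = refl
  ; below = Below-∷ (minus y) below ℤ.≤-refl (ℤ.+≤+ z≤n)
  ; peak = peak′ ps peak }
  where
  peak′ : ∀ ps {x} →
          (∀ {x} → last (p ∷ ps) ≡ just x → FirstPeak (+ suc (length ps)) x w) →
          last ps ≡ just x → FirstPeak (+ length ps) x (minus y ∷ w)
  -- The new - cancels the leftmost +, so the last + is unchanged as long as one is left. With none
  -- left, the empty prefix attains the maximum 0 and no peak is claimed.
  peak′ (_ ∷ _) pk eq = FirstPeak-∷ (minus y) (pk eq) (ℤ.+<+ ℕ.z<s)

rightmostPlus : Word → Maybe (Sign × Position)
rightmostPlus w = last (filter (λ s → proj₁ s Sign.≟ Sign.+) (reduce w))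

filter-plus : ∀ (ps ms : List Position) → filter (λ s → proj₁ s Sign.≟ Sign.+)
  (marked Sign.+ ps ++ marked Sign.- ms) ≡ marked Sign.+ ps
filter-plus (p ∷ ps) ms       = cong (plus p ∷_) (filter-plus ps ms)
filter-plus []       []       = refl
filter-plus []       (m ∷ ms) = filter-plus [] ms

last-map : ∀ (f : A → B) xs {y} → last (map f xs) ≡ just y →
           ∃ λ x → last xs ≡ just x × y ≡ f x
last-map f (x ∷ [])      refl = x , refl , refl
last-map f (x ∷ y ∷ xs) eq    = last-map f (y ∷ xs) eq

last-nothing : ∀ {xs : List A} → last xs ≡ nothing → xs ≡ []
last-nothing {xs = []}         _  = refl
last-nothing {xs = _ ∷ x ∷ xs} eq with () ← last-nothing {xs = x ∷ xs} eq

rightmostPlus-just : ∀ w {s} → rightmostPlus w ≡ just s →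
  ∃₂ λ k x → s ≡ plus x × Below (+ suc k) w × FirstPeak (+ suc k) x w
rightmostPlus-just w eq with reduction w
... | record { pluses = ps ; minuses = ms ; shape = sh ; below = below ; peak = peak }
  rewrite sh | filter-plus ps ms with last-map (λ x → plus x) ps eq
rightmostPlus-just w eq | record { pluses = p ∷ ps ; below = below ; peak = peak }
  | x , last≡ , refl = length ps , x , refl , below , peak last≡

rightmostPlus-nothing : ∀ w → rightmostPlus w ≡ nothing → Below 0ℤ w
rightmostPlus-nothing w eq with reduction w
... | record { pluses = [] ; below = below } = below
... | record { pluses = p ∷ ps ; minuses = ms ; shape = sh }
  rewrite sh | filter-plus (p ∷ ps) ms with () ← last-nothing {xs = marked Sign.+ (p ∷ ps)} eq

-- In a word that runs along the ladders, with the + of a ladder before its −, the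
-- letters counted for n form the prefix that ends with the + of ladder n.
module Cuts (key : Position → ℕ) where

  Before : Sign × Position → Sign × Position → Set
  Before s t = key (proj₂ s) ≤ key (proj₂ t) ×
    (key (proj₂ s) ≡ key (proj₂ t) → proj₁ s ≡ Sign.- → proj₁ t ≡ Sign.+ → ⊥)

  Counted : ℕ → Sign × Position → Set
  Counted n (plus  x) = key x ≤ n
  Counted n (minus x) = key x < n

  counted? : ∀ n → Decidable (Counted n)
  counted? n (plus  x) = key x ≤? n
  counted? n (minus x) = key x <? n

  val : ℕ → Sign × Position → ℤ
  val n s = ind (counted? n s) ℤ.* sgn s

  val-in : ∀ {n} s → Counted n s → val n s ≡ sgn s
  val-in {n} s c = trans (cong (ℤ._* sgn s) (ind-yes (counted? n s) c)) (ℤ.*-identityˡ _)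

  val-out : ∀ {n} s → ¬ Counted n s → val n s ≡ 0ℤ
  val-out {n} s ¬c = cong (ℤ._* sgn s) (ind-no (counted? n s) ¬c)

  Counted-down : ∀ {n} s t → Before s t → Counted n t → Counted n s
  Counted-down (plus  x) (plus  y) (le , _)  c = ℕ.≤-trans le c
  Counted-down (plus  x) (minus y) (le , _)  c = ℕ.≤-trans le (ℕ.<⇒≤ c)
  Counted-down (minus x) (minus y) (le , _)  c = ℕ.≤-<-trans le c
  -- The order within a ladder enters here: a - may precede a + only from a strictly earlier ladder.
  Counted-down (minus x) (plus  y) (le , ne) c =
    ℕ.<-≤-trans (ℕ.≤∧≢⇒< le λ e → ne e refl refl) c

  cut : ∀ n {w} → AllPairs Before w →
        ∃₂ λ u v → u ++ v ≡ w × All (Counted n) u × All (¬_ ∘ Counted n) v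
  cut n [] = [] , [] , refl , [] , []
  cut n {s ∷ w} (b ∷ bs) with counted? n s
  ... | no ¬c = [] , s ∷ w , refl , [] ,
          ¬c ∷ All.map (λ {t} st → ¬c ∘ Counted-down s t st) b
  ... | yes c with u , v , eq , inside , outside ← cut n bs =
    s ∷ u , v , cong (s ∷_) eq , c ∷ inside , outside

  ∑val : ∀ n {u v} → All (Counted n) u → All (¬_ ∘ Counted n) v →
         ∑ (val n) (u ++ v) ≡ height u
  ∑val n {u} {v} inside outside = begin
    ∑ (val n) (u ++ v)          ≡⟨ ∑-++ (val n) u v ⟩
    ∑ (val n) u ℤ.+ ∑ (val n) v ≡⟨ cong₂ ℤ._+_
      (∑-cong (All.map (λ {s} → val-in s) inside))
      (∑-zero (All.map (λ {s} → val-out s) outside)) ⟩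
    height u ℤ.+ 0ℤ             ≡⟨ ℤ.+-identityʳ _ ⟩
    height u                    ∎
    where open ≡-Reasoning

  ∑val-≤ : ∀ {w k} → AllPairs Before w → Below k w → ∀ m → ∑ (val m) w ℤ.≤ k
  ∑val-≤ bs below m with u , v , refl , inside , outside ← cut m bs =
    ℤ.≤-trans (ℤ.≤-reflexive (∑val m inside outside)) (below u v refl)

  prefix : ∀ {P : Sign × Position → Set} u {v} u₀ {x v₀} → u ++ v ≡ u₀ ++ x ∷ v₀ →
           All P u → ¬ P x → ∃ λ u₁ → u ++ u₁ ≡ u₀
  prefix []      u₀       eq   ps       ¬p = u₀ , refl
  prefix (s ∷ u) []       refl (p ∷ ps) ¬p = ⊥-elim (¬p p)
  prefix (s ∷ u) (t ∷ u₀) eq   (p ∷ ps) ¬p with refl , eq′ ← ∷-injective eq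
    with u₁ , refl ← prefix u u₀ eq′ ps ¬p = u₁ , refl

  -- The letter `plus x` is not counted for m, so the counted prefix ends before it, where the
  -- height k has not yet been reached.
  ∑val-< : ∀ {w k x m} → AllPairs Before w → FirstPeak k x w → m < key x →
           ∑ (val m) w ℤ.< k
  ∑val-< {m = m} bs (u₀ , v₀ , refl , _ , first) lt
    with u , v , eq , inside , outside ← cut m bs
    with u₁ , eq′ ← prefix u u₀ eq inside (ℕ.<⇒≱ lt) =
    subst (λ w → ∑ (val m) w ℤ.< _) eq
      (ℤ.≤-<-trans (ℤ.≤-reflexive (∑val m inside outside)) (first u u₁ eq′))

  -- A - behind x lies on the ladder of x or on a later one, where it is not counted.
  val-after-plus : ∀ {x} s → Before (plus x) s → 0ℤ ℤ.≤ val (key x) s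
  val-after-plus {x} (plus  y) b        =
    subst (0ℤ ℤ.≤_) (sym (ℤ.*-identityʳ _)) (ind-nonneg (key y ≤? key x))
  val-after-plus {x} (minus y) (le , _) =
    ℤ.≤-reflexive (sym (val-out (minus y) (ℕ.≤⇒≯ le)))

  module _ {x : Position} {k : ℤ} {w : Word} (bs : AllPairs Before w) (below : Below k w) where

    private
      split : ∀ u v → u ++ plus x ∷ v ≡ w →
              ∑ (val (key x)) w ≡ height u ℤ.+ 1ℤ ℤ.+ ∑ (val (key x)) v
      split u v refl = begin
        ∑ (val n) (u ++ plus x ∷ v)
          ≡⟨ ∑-++ (val n) u _ ⟩
        ∑ (val n) u ℤ.+ (val n (plus x) ℤ.+ ∑ (val n) v)
          ≡⟨ cong₂ ℤ._+_
               (∑-cong (All.map (λ {s} b → val-in s (Counted-down s (plus x) b ℕ.≤-refl))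
                 (proj₁ (AllPairs-middle u bs))))
               (cong (ℤ._+ ∑ (val n) v) (val-in (plus x) ℕ.≤-refl)) ⟩
        height u ℤ.+ (1ℤ ℤ.+ ∑ (val n) v)
          ≡⟨ ℤ.+-assoc (height u) 1ℤ _ ⟨
        height u ℤ.+ 1ℤ ℤ.+ ∑ (val n) v ∎
        where
        open ≡-Reasoning
        n = key x

      nonneg : ∀ u v → u ++ plus x ∷ v ≡ w → All (λ s → 0ℤ ℤ.≤ val (key x) s) v
      nonneg u v refl = All.map (λ {s} → val-after-plus s)
        (proj₂ (AllPairs-middle u bs))

      ∑0 : ∀ v → ∑ (λ (_ : Sign × Position) → 0ℤ) v ≡ 0ℤ
      ∑0 v = ∑-zero (All.tabulate {xs = v} λ _ → refl)

    -- The letters counted for `key x` are all those up to x, of height k, and behind x only some +.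
    -- The sum is thus at least k, and `Below` bounds it from above.
    ∑val-peak : FirstPeak k x w → ∑ (val (key x)) w ≡ k
    ∑val-peak (u , v , eq , top , _) = ℤ.≤-antisym (∑val-≤ bs below (key x)) (begin
      k                                   ≡⟨ top ⟨
      height u ℤ.+ 1ℤ                     ≡⟨ ℤ.+-identityʳ _ ⟨
      height u ℤ.+ 1ℤ ℤ.+ 0ℤ              ≡⟨ cong (ℤ._+_ (height u ℤ.+ 1ℤ)) (∑0 v) ⟨
      height u ℤ.+ 1ℤ ℤ.+ ∑ (λ _ → 0ℤ) v  ≤⟨ ℤ.+-monoʳ-≤ (height u ℤ.+ 1ℤ)
                                               (∑-mono (nonneg u v eq)) ⟩
      height u ℤ.+ 1ℤ ℤ.+ ∑ (val (key x)) v ≡⟨ split u v eq ⟨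
      ∑ (val (key x)) w                   ∎)
      where open ℤ.≤-Reasoning

    -- A + behind x on a ladder up to `key x` would be counted as well and lift the sum above k.
    peak-last : (p : FirstPeak k x w) → ∀ {y} → plus y ∈ˡ proj₁ (proj₂ p) →
                key x < key y
    peak-last p@(u , v , eq , top , _) {y} y∈v = ℕ.≰⇒> λ le → ℤ.<-irrefl refl (begin-strict
      k                                   ≡⟨ top ⟨
      height u ℤ.+ 1ℤ                     ≡⟨ ℤ.+-identityʳ _ ⟨
      height u ℤ.+ 1ℤ ℤ.+ 0ℤ              ≡⟨ cong (ℤ._+_ (height u ℤ.+ 1ℤ)) (∑0 v) ⟨
      height u ℤ.+ 1ℤ ℤ.+ ∑ (λ _ → 0ℤ) v  <⟨ ℤ.+-monoʳ-< (height u ℤ.+ 1ℤ)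
        (∑-mono-< (nonneg u v eq) y∈v
          (ℤ.<-≤-trans (ℤ.+<+ ℕ.z<s) (ℤ.≤-reflexive (sym (val-in (plus y) le))))) ⟩
      height u ℤ.+ 1ℤ ℤ.+ ∑ (val (key x)) v ≡⟨ split u v eq ⟨
      ∑ (val (key x)) w                   ≡⟨ ∑val-peak p ⟩
      k                                   ∎)
      where open ℤ.≤-Reasoning

-- Sums over initial segments

∑-map : ∀ (f : B → ℤ) (g : A → B) xs → ∑ f (map g xs) ≡ ∑ (f ∘ g) xs
∑-map f g []       = refl
∑-map f g (x ∷ xs) = cong (ℤ._+_ (f (g x))) (∑-map f g xs)

∑-concatMap : ∀ (f : B → ℤ) (g : A → List B) xs →
              ∑ f (concatMap g xs) ≡ ∑ (∑ f ∘ g) xs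
∑-concatMap f g []       = refl
∑-concatMap f g (x ∷ xs) =
  trans (∑-++ f (g x) _) (cong (ℤ._+_ (∑ f (g x))) (∑-concatMap f g xs))

∑-mapMaybe : ∀ (f : B → ℤ) (g : A → Maybe B) xs →
             ∑ f (mapMaybe g xs) ≡ ∑ (maybe′ f 0ℤ ∘ g) xs
∑-mapMaybe f g [] = refl
∑-mapMaybe f g (x ∷ xs) with g x
... | just y  = cong (ℤ._+_ (f y)) (∑-mapMaybe f g xs)
... | nothing = trans (∑-mapMaybe f g xs) (sym (ℤ.+-identityˡ _))

∑< : ℕ → (ℕ → ℤ) → ℤ
∑< zero    f = 0ℤ
∑< (suc n) f = ∑< n f ℤ.+ f n

∑-upTo : ∀ f n → ∑ f (upTo n) ≡ ∑< n f
∑-upTo f zero    = refl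
∑-upTo f (suc n) = begin
  ∑ f (upTo (suc n))              ≡⟨ cong (∑ f) (upTo-∷ʳ n) ⟨
  ∑ f (upTo n ∷ʳ n)               ≡⟨ ∑-++ f (upTo n) (n ∷ []) ⟩
  ∑ f (upTo n) ℤ.+ (f n ℤ.+ 0ℤ)   ≡⟨ cong₂ ℤ._+_ (∑-upTo f n) (ℤ.+-identityʳ _) ⟩
  ∑< n f ℤ.+ f n                  ∎
  where open ≡-Reasoning

∑<-cong : ∀ n {f g} → (∀ {k} → k < n → f k ≡ g k) → ∑< n f ≡ ∑< n g
∑<-cong zero    eq = refl
∑<-cong (suc n) eq =
  cong₂ ℤ._+_ (∑<-cong n λ lt → eq (ℕ.m<n⇒m<1+n lt)) (eq ℕ.≤-refl)

∑<-zero : ∀ n {f} → (∀ {k} → k < n → f k ≡ 0ℤ) → ∑< n f ≡ 0ℤ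
∑<-zero zero    eq = refl
∑<-zero (suc n) eq =
  cong₂ ℤ._+_ (∑<-zero n λ lt → eq (ℕ.m<n⇒m<1+n lt)) (eq ℕ.≤-refl)

interchange : ∀ a b c d → (a ℤ.+ b) ℤ.+ (c ℤ.+ d) ≡ (a ℤ.+ c) ℤ.+ (b ℤ.+ d)
interchange = ℤ-Solver.solve-∀

∑<-+ : ∀ n f g → ∑< n (λ k → f k ℤ.+ g k) ≡ ∑< n f ℤ.+ ∑< n g
∑<-+ zero    f g = refl
∑<-+ (suc n) f g = trans (cong (ℤ._+ (f n ℤ.+ g n)) (∑<-+ n f g)) 
  (interchange (∑< n f) (∑< n g) (f n) (g n))

∑<-telescope : ∀ n (f : ℕ → ℤ) → f 0 ℤ.+ ∑< n (λ k → f (suc k) ℤ.- f k) ≡ f n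
∑<-telescope zero    f = ℤ.+-identityʳ _
∑<-telescope (suc n) f = begin
  f 0 ℤ.+ (S ℤ.+ (f (suc n) ℤ.- f n)) ≡⟨ ℤ.+-assoc (f 0) S _ ⟨
  f 0 ℤ.+ S ℤ.+ (f (suc n) ℤ.- f n)   ≡⟨ cong (ℤ._+ (f (suc n) ℤ.- f n)) (∑<-telescope n f) ⟩
  f n ℤ.+ (f (suc n) ℤ.- f n)         ≡⟨ cancel (f n) _ ⟩
  f (suc n)                           ∎
  where
  open ≡-Reasoning
  S = ∑< n (λ k → f (suc k) ℤ.- f k)
  cancel : ∀ x y → x ℤ.+ (y ℤ.- x) ≡ y
  cancel = ℤ-Solver.solve-∀

∑<-extend : ∀ m n {f} → m ≤ n → (∀ {k} → m ≤ k → f k ≡ 0ℤ) → ∑< n f ≡ ∑< m f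
∑<-extend m n {f} le eq with ℕ.m≤n⇒∃[o]m+o≡n le
... | o , refl = go o
  where
  go : ∀ o → ∑< (m + o) f ≡ ∑< m f
  go zero    = cong (λ k → ∑< k f) (ℕ.+-identityʳ m)
  go (suc o) rewrite ℕ.+-suc m o =
    trans (cong₂ ℤ._+_ (go o) (eq (ℕ.m≤m+n m o))) (ℤ.+-identityʳ _)

∑<-update : ∀ n {f g : ℕ → ℤ} {a δ} → a < n → (∀ k → k ≢ a → g k ≡ f k) →
            g a ≡ f a ℤ.+ δ → ∑< n g ≡ ∑< n f ℤ.+ δ
∑<-update (suc n) {f} {g} {a} {δ} lt other at with a ≟ n
... | yes refl = trans
  (cong₂ ℤ._+_ (∑<-cong n λ k<n → other _ (ℕ.<⇒≢ k<n)) at)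
  (sym (ℤ.+-assoc (∑< n f) (f a) δ))
... | no a≢n = trans
  (cong₂ ℤ._+_ (∑<-update n (ℕ.≤∧≢⇒< (ℕ.≤-pred lt) a≢n) other at) (other n (a≢n ∘ sym)))
  (swap (∑< n f) δ (f n))
  where
  swap : ∀ x y z → x ℤ.+ y ℤ.+ z ≡ x ℤ.+ z ℤ.+ y
  swap = ℤ-Solver.solve-∀

-- Partitions by their rows

row-end : ∀ μ a → length (parts μ) ≤ a → row μ a ≡ 0
row-end μ = nth-end (parts μ)

antitone-≤ : ∀ {g} → Antitone g → ∀ {a c} → a ≤ c → g c ≤ g a
antitone-≤ {g} anti {a} le with ℕ.m≤n⇒∃[o]m+o≡n le
... | o , refl = go o
  where
  go : ∀ o → g (a + o) ≤ g a
  go zero    rewrite ℕ.+-identityʳ a = ℕ.≤-refl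
  go (suc o) rewrite ℕ.+-suc a o = ℕ.≤-trans (anti (a + o)) (go o)

row-≤ : ∀ μ {a c} → a ≤ c → row μ c ≤ row μ a
row-≤ μ = antitone-≤ (row-antitone μ)

-- Adding a box in terms of row lengths. Read from m to l it also describes the removal of x.
record Grow (l : Partition) (x : Position) (m : Partition) : Set where
  field
    at-old : row l (proj₁ x) ≡ proj₂ x
    at-new : row m (proj₁ x) ≡ suc (proj₂ x)
    other  : ∀ c → c ≢ proj₁ x → row m c ≡ row l c

  addCriterion : AddCriterion l x
  addCriterion = sym at-old , λ c eq → ℕ.≤-trans (ℕ.≤-reflexive (sym at-new))
    (ℕ.≤-trans (row-≤ m (ℕ.≤-trans (ℕ.n≤1+n c) (ℕ.≤-reflexive (sym eq))))
      (ℕ.≤-reflexive (other c λ e → ℕ.1+n≢n (sym (trans e eq)))))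

  removeCriterion : RemoveCriterion m x
  removeCriterion = sym at-new , ℕ.≤-trans (ℕ.≤-reflexive (other _ ℕ.1+n≢n))
    (ℕ.≤-trans (row-antitone l _) (ℕ.≤-reflexive at-old))

private
  below⇒≤ : ∀ {m n} → (∀ d → d < m → d < n) → m ≤ n
  below⇒≤ {zero}  h = z≤n
  below⇒≤ {suc m} h = h m ℕ.≤-refl

  rows-≡ : ∀ {m n} → (∀ d → d < m → d < n) → (∀ d → d < n → d < m) → m ≡ n
  rows-≡ f g = ℕ.≤-antisym (below⇒≤ f) (below⇒≤ g)

open Equivalence using () renaming (to to ⇔-to; from to ⇔-from)

IsAdd⇒Grow : ∀ {l x m} → IsAdd l x m → Grow l x m
IsAdd⇒Grow {l} {a , b} {m} (x∉l , spec) = record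
  { at-old = old
  ; at-new = rows-≡
      (λ d lt → to-new d (⇔-to (spec (a , d)) lt))
      (λ d lt → ⇔-from (spec (a , d)) (from-new d (ℕ.m≤n⇒m<n∨m≡n (ℕ.≤-pred lt))))
  ; other = λ c ne → rows-≡ (λ d lt → strip ne (⇔-to (spec (c , d)) lt))
      (λ d lt → ⇔-from (spec (c , d)) (inj₁ lt))
  }
  where
  old : row l a ≡ b
  old = sym (proj₁ (addable⇒criterion l (a , b) (m , x∉l , spec)))
  to-new : ∀ d → (a , d) ∈ l ⊎ (a , d) ≡ (a , b) → d < suc b
  to-new d (inj₁ lt)   = ℕ.m<n⇒m<1+n (ℕ.<-≤-trans lt (ℕ.≤-reflexive old))
  to-new d (inj₂ refl) = ℕ.≤-refl
  from-new : ∀ d → d < b ⊎ d ≡ b → (a , d) ∈ l ⊎ (a , d) ≡ (a , b)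
  from-new d (inj₁ lt)   = inj₁ (ℕ.<-≤-trans lt (ℕ.≤-reflexive (sym old)))
  from-new d (inj₂ refl) = inj₂ refl
  strip : ∀ {c d} → c ≢ a → (c , d) ∈ l ⊎ (c , d) ≡ (a , b) → (c , d) ∈ l
  strip ne (inj₁ lt)   = lt
  strip ne (inj₂ refl) = ⊥-elim (ne refl)

IsRemove⇒Grow : ∀ {m x l} → IsRemove m x l → Grow l x m
IsRemove⇒Grow {m} {a , b} {l} (x∈m , spec) = record
  { at-old = rows-≡
      (λ d lt → let p , ne = ⇔-to (spec (a , d)) lt in
        ℕ.≤∧≢⇒< (ℕ.≤-pred (ℕ.<-≤-trans p (ℕ.≤-reflexive new))) λ { refl → ne refl })
      (λ d lt → ⇔-from (spec (a , d))
        (ℕ.<-≤-trans (ℕ.m<n⇒m<1+n lt) (ℕ.≤-reflexive (sym new)) ,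
         λ { refl → ℕ.<-irrefl refl lt }))
  ; at-new = new
  ; other = λ c ne → rows-≡
      (λ d lt → ⇔-from (spec (c , d)) (lt , λ { refl → ne refl }))
      (λ d lt → proj₁ (⇔-to (spec (c , d)) lt))
  }
  where
  new : row m a ≡ suc b
  new = sym (proj₁ (removable⇒criterion m (a , b) (l , x∈m , spec)))

parts-unique : ∀ {xs ys} → All (0 <_) xs → All (0 <_) ys → nth xs ≗ nth ys → xs ≡ ys
parts-unique []       []       eq = refl
parts-unique []       (q ∷ qs) eq = ⊥-elim (ℕ.<⇒≢ q (eq 0))
parts-unique (p ∷ ps) []       eq = ⊥-elim (ℕ.<⇒≢ p (sym (eq 0)))
parts-unique (p ∷ ps) (q ∷ qs) eq =
  cong₂ _∷_ (eq 0) (parts-unique ps qs (eq ∘ suc))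

positive : ∀ μ → All (0 <_) (parts μ)
positive ⟨ xs , p ⟩ = proj₂ (recompute (linked? ℕ._≥?_ xs ×-dec All.all? (0 <?_) xs) p)

partition-≡ : ∀ {l m} → parts l ≡ parts m → l ≡ m
partition-≡ refl = refl

row-injective : ∀ {l m} → row l ≗ row m → l ≡ m
row-injective {l} {m} eq = partition-≡ (parts-unique (positive l) (positive m) eq)

Grow-functional : ∀ {l x m n} → Grow l x m → Grow l x n → m ≡ n
Grow-functional {x = a , b} g h = row-injective λ c → eq c
  where
  module g = Grow g
  module h = Grow h
  eq : ∀ c → _
  eq c with c ≟ a
  ... | yes refl = trans g.at-new (sym h.at-new)
  ... | no ne    = trans (g.other c ne) (sym (h.other c ne))

-- Records that nothing earlier qualifies, because `shrink` has to remove the first - of a ladder.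
first-any : ∀ {P : A → Set} → Decidable P → ∀ {xs} → Any P xs →
            ∃₂ λ u x → ∃ λ v → u ++ x ∷ v ≡ xs × P x × All (¬_ ∘ P) u
first-any P? {x ∷ xs} any with P? x | any
... | yes p | _       = [] , x , xs , refl , p , []
... | no ¬p | here p  = ⊥-elim (¬p p)
... | no ¬p | there i with u , y , v , eq , p , none ← first-any P? i =
  x ∷ u , y , v , cong (x ∷_) eq , p , ¬p ∷ none

∑<-nonneg : ∀ n {f} → (∀ k → 0ℤ ℤ.≤ f k) → 0ℤ ℤ.≤ ∑< n f
∑<-nonneg zero    h = ℤ.≤-refl
∑<-nonneg (suc n) h = ℤ.+-mono-≤ (∑<-nonneg n h) (h n)

∑<-pos : ∀ n {f k} → (∀ k → 0ℤ ℤ.≤ f k) → k < n → 0ℤ ℤ.< f k → 0ℤ ℤ.< ∑< n f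
∑<-pos (suc n) {f} {k} h lt pos with k ≟ n
... | yes refl = ℤ.+-mono-≤-< (∑<-nonneg n h) pos
... | no ne    = ℤ.+-mono-<-≤ (∑<-pos n h (ℕ.≤∧≢⇒< (ℕ.≤-pred lt) ne) pos) (h n)

≤∨≡ : ∀ {m n} → m ≤ suc n → m ≤ n ⊎ m ≡ suc n
≤∨≡ le with ℕ.m≤n⇒m<n∨m≡n le
... | inj₁ lt = inj₁ (ℕ.≤-pred lt)
... | inj₂ eq = inj₂ eq

pos⇒suc : ∀ {n} → 0 < n → ∃ λ m → n ≡ suc m
pos⇒suc {suc m} _ = m , refl

Grow-≤ : ∀ {l x m} → Grow l x m → ∀ c → row l c ≤ row m c
Grow-≤ {x = a , b} g c with c ≟ a
... | yes refl = ℕ.≤-trans (ℕ.≤-reflexive (Grow.at-old g))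
                   (ℕ.≤-trans (ℕ.n≤1+n b) (ℕ.≤-reflexive (sym (Grow.at-new g))))
... | no ne    = ℕ.≤-reflexive (sym (Grow.other g c ne))

-- Sorted lists and their rearrangements

AllPairs-with : ∀ {P : A → Set} {R : A → A → Set} {xs} → All P xs → AllPairs R xs →
                AllPairs (λ s t → P s × P t × R s t) xs
AllPairs-with []       []       = []
AllPairs-with (p ∷ ps) (r ∷ rs) =
  All.zipWith (λ (q , s) → p , q , s) (ps , r) ∷ AllPairs-with ps rs

AllPairs-reverse : ∀ {R : A → A → Set} {xs} → AllPairs R xs → AllPairs (flip R) (reverse xs)
AllPairs-reverse [] = []
AllPairs-reverse {R = R} {x ∷ xs} (r ∷ rs) = subst (AllPairs (flip R)) (sym (unfold-reverse x xs))
  (AllPairs.++⁺ (AllPairs-reverse rs) ([] ∷ []) (All.map (_∷ []) (All-resp-↭ (↭-sym (↭-reverse xs)) r)))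

AllPairs-mapMaybe : ∀ {R : A → A → Set} {S : B → B → Set} (f : A → Maybe B) →
  (∀ {x y s t} → f x ≡ just s → f y ≡ just t → R x y → S s t) →
  ∀ {xs} → AllPairs R xs → AllPairs S (mapMaybe f xs)
AllPairs-mapMaybe f h [] = []
AllPairs-mapMaybe {R = R} {S = S} f h {x ∷ xs} (r ∷ rs) with f x in fx
... | nothing = AllPairs-mapMaybe f h rs
... | just s  = go xs r ∷ AllPairs-mapMaybe f h rs
  where
  go : ∀ ys → All (R x) ys → All (S s) (mapMaybe f ys)
  go []       []       = []
  go (y ∷ ys) (q ∷ qs) with f y in fy
  ... | nothing = go ys qs
  ... | just t  = h fx fy q ∷ go ys qs

AllPairs-concatMap : ∀ {R : B → B → Set} (f : ℕ → List B) n → (∀ k → AllPairs R (f k)) →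
  (∀ {i j} → i < j → All (λ s → All (R s) (f j)) (f i)) →
  AllPairs R (concatMap f (upTo n))
AllPairs-concatMap f n inner outer = AllPairs.concat⁺
  (All.map⁺ (All.tabulate λ {k} _ → inner k))
  (AllPairs.map⁺ (AllPairs.applyUpTo⁺₁ id n λ i<j _ → outer i<j))

-- Every element lies on exactly one level. The induction compares the first k levels with the
-- elements whose key is below k.
concatMap-filter-↭ : ∀ (key : A → ℕ) n {xs} → All (λ x → key x < n) xs →
  concatMap (λ k → filter (λ x → key x ≟ k) xs) (upTo n) ↭ xs
concatMap-filter-↭ key n {xs} bounded =
  ↭-trans (go n) (↭-reflexive (filter-all (λ x → key x <? n) bounded))
  where
  level : ℕ → List _ → List _
  level k = filter (λ x → key x ≟ k)
  upto : ℕ → List _ → List _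
  upto k = filter (λ x → key x <? k)
  split : ∀ k ys → upto k ys ++ level k ys ↭ upto (suc k) ys
  split k [] = ↭-reflexive refl
  split k (y ∷ ys) with ℕ.<-cmp (key y) k
  ... | tri< lt ≢ _ rewrite filter-accept (λ x → key x <? k) {xs = ys} lt
                          | filter-reject (λ x → key x ≟ k) {xs = ys} ≢
                          | filter-accept (λ x → key x <? suc k) {xs = ys} (ℕ.m<n⇒m<1+n lt) =
    ↭.prep y (split k ys)
  ... | tri≈ ≮ eq _ rewrite filter-reject (λ x → key x <? k) {xs = ys} ≮
                          | filter-accept (λ x → key x ≟ k) {xs = ys} eq
                          | filter-accept (λ x → key x <? suc k) {xs = ys}
                              (ℕ.≤-reflexive (cong suc eq)) =
    ↭-trans (↭-shift y (upto k ys) (level k ys)) (↭.prep y (split k ys))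
  ... | tri> ≮ ≢ gt rewrite filter-reject (λ x → key x <? k) {xs = ys} ≮
                          | filter-reject (λ x → key x ≟ k) {xs = ys} ≢
                          | filter-reject (λ x → key x <? suc k) {xs = ys} (ℕ.<⇒≱ gt ∘ ℕ.≤-pred) =
    split k ys
  go : ∀ k → concatMap (λ k → level k xs) (upTo k) ↭ upto k xs
  go zero    = ↭-reflexive (sym (filter-none (λ x → key x <? 0) {xs} (All.tabulate λ _ ())))
  go (suc k) = begin
    concatMap (λ k → level k xs) (upTo (suc k))
      ≡⟨ cong (concatMap (λ k → level k xs)) (upTo-∷ʳ k) ⟨
    concatMap (λ k → level k xs) (upTo k ++ k ∷ [])
      ≡⟨ concatMap-++ (λ k → level k xs) (upTo k) (k ∷ []) ⟩
    concatMap (λ k → level k xs) (upTo k) ++ (level k xs ++ [])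
      ↭⟨ ++⁺ (go k) (↭-reflexive (++-identityʳ (level k xs))) ⟩
    upto k xs ++ level k xs
      ↭⟨ split k xs ⟩
    upto (suc k) xs ∎
    where open PermutationReasoning

∑-length-filter : ∀ {P : A → Set} (P? : Decidable P) xs →
                  + length (filter P? xs) ≡ ∑ (λ x → ind (P? x)) xs
∑-length-filter P? [] = refl
∑-length-filter P? (x ∷ xs) with P? x
... | yes _ = cong (ℤ._+_ 1ℤ) (∑-length-filter P? xs)
... | no _  = trans (∑-length-filter P? xs) (sym (ℤ.+-identityˡ _))

-- Ladders

module Ladders (d : ℕ) where

  -- Writing ℓ as `d + 2` makes the slope `e` of the ladders a successor by definition, so that it
  -- can be cancelled.
  e ℓ : ℕ
  e = suc d
  ℓ = suc e

  -- This is `ladder` without its leading `suc`; only order and differences of ladders matter.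
  lad : Position → ℕ
  lad (a , b) = a + e * b

  lad-right : ∀ a b → lad (a , suc b) ≡ lad (a , b) + e
  lad-right a b = shuffle a b d
    where
    shuffle : ∀ a b d → a + suc d * suc b ≡ a + suc d * b + suc d
    shuffle = ℕ-Solver.solve-∀

  lad-diagonal : ∀ a b → lad (suc a , suc b) ≡ lad (a , b) + ℓ
  lad-diagonal a b = trans (cong suc (lad-right a b)) (sym (ℕ.+-suc _ e))

  lad-mono : ∀ {a b a′ b′} → a ≤ a′ → b ≤ b′ → lad (a , b) ≤ lad (a′ , b′)
  lad-mono p q = ℕ.+-mono-≤ p (ℕ.*-monoʳ-≤ e q)

  lad-mono-<ˡ : ∀ {a b a′ b′} → a < a′ → b ≤ b′ → lad (a , b) < lad (a′ , b′)
  lad-mono-<ˡ p q = ℕ.+-mono-<-≤ p (ℕ.*-monoʳ-≤ e q)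

  lad-same-row : ∀ {a b b′} → lad (a , b) ≡ lad (a , b′) → b ≡ b′
  lad-same-row {a} {b} {b′} eq =
    ℕ.*-cancelˡ-≡ b b′ e (ℕ.+-cancelˡ-≡ a (e * b) (e * b′) eq)

  -- Ladder m contains the position (m , 0).
  color : ℕ → Fin ℓ
  color m = residue ℓ (m , 0)

  private
    quotient-≮ : ∀ {r s r′ s′} → r < ℓ → + r ℤ.+ s ℤ.* + ℓ ≡ + r′ ℤ.+ s′ ℤ.* + ℓ →
                 ¬ s ℤ.< s′
    quotient-≮ {r} {s} {r′} {s′} r<ℓ eq lt = ℤ.<-irrefl eq (begin-strict
      + r ℤ.+ s ℤ.* + ℓ     <⟨ ℤ.+-monoˡ-< (s ℤ.* + ℓ) (ℤ.+<+ r<ℓ) ⟩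
      + ℓ ℤ.+ s ℤ.* + ℓ     ≡⟨ ℤ.suc-* s (+ ℓ) ⟨
      ℤ.suc s ℤ.* + ℓ       ≤⟨ ℤ.*-monoʳ-≤-nonNeg (+ ℓ) (ℤ.i<j⇒suc[i]≤j lt) ⟩
      s′ ℤ.* + ℓ            ≡⟨ ℤ.+-identityˡ _ ⟨
      0ℤ ℤ.+ s′ ℤ.* + ℓ     ≤⟨ ℤ.+-monoˡ-≤ (s′ ℤ.* + ℓ) (ℤ.+≤+ {n = r′} z≤n) ⟩
      + r′ ℤ.+ s′ ℤ.* + ℓ   ∎)
      where open ℤ.≤-Reasoning

    remainder-unique : ∀ {r s r′ s′} → r < ℓ → r′ < ℓ →
      + r ℤ.+ s ℤ.* + ℓ ≡ + r′ ℤ.+ s′ ℤ.* + ℓ → r ≡ r′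
    remainder-unique {r} {s} {r′} {s′} r<ℓ r′<ℓ eq with ℤ.<-cmp s s′
    ... | tri< lt _ _ = ⊥-elim (quotient-≮ {r} {s} {r′} {s′} r<ℓ eq lt)
    ... | tri> _ _ lt = ⊥-elim (quotient-≮ {r′} {s′} {r} {s} r′<ℓ (sym eq) lt)
    ... | tri≈ _ refl _ = ℤ.+-injective (begin
      + r                                   ≡⟨ cancel (+ r) t ⟨
      + r ℤ.+ t ℤ.- t                       ≡⟨ cong (ℤ._- t) eq ⟩
      + r′ ℤ.+ t ℤ.- t                      ≡⟨ cancel (+ r′) t ⟩
      + r′                                  ∎)
      where
      open ≡-Reasoning
      t = s ℤ.* + ℓ
      cancel : ∀ x y → x ℤ.+ y ℤ.- y ≡ x
      cancel = ℤ-Solver.solve-∀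

    %ℕ-cong : ∀ {x} y q → x ≡ y ℤ.+ q ℤ.* + ℓ → x %ℕ ℓ ≡ y %ℕ ℓ
    %ℕ-cong {x} y q eq = remainder-unique {s = x /ℕ ℓ} {s′ = y /ℕ ℓ ℤ.+ q}
      (n%ℕd<d x ℓ) (n%ℕd<d y ℓ) (begin
      + (x %ℕ ℓ) ℤ.+ x /ℕ ℓ ℤ.* + ℓ           ≡⟨ a≡a%ℕn+[a/ℕn]*n x ℓ ⟨
      x                                        ≡⟨ eq ⟩
      y ℤ.+ q ℤ.* + ℓ
        ≡⟨ cong (ℤ._+ q ℤ.* + ℓ) (a≡a%ℕn+[a/ℕn]*n y ℓ) ⟩
      + (y %ℕ ℓ) ℤ.+ y /ℕ ℓ ℤ.* + ℓ ℤ.+ q ℤ.* + ℓ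
        ≡⟨ dist (+ (y %ℕ ℓ)) (y /ℕ ℓ) q (+ ℓ) ⟩
      + (y %ℕ ℓ) ℤ.+ (y /ℕ ℓ ℤ.+ q) ℤ.* + ℓ    ∎)
      where
      open ≡-Reasoning
      dist : ∀ r s q l → r ℤ.+ s ℤ.* l ℤ.+ q ℤ.* l ≡ r ℤ.+ (s ℤ.+ q) ℤ.* l
      dist = ℤ-Solver.solve-∀

  -- Because b - a = -(a + (ℓ - 1) b) + b ℓ, the residue depends only on the ladder.
  residue-lad : ∀ x → residue ℓ x ≡ color (lad x)
  residue-lad (a , b) = Fin.fromℕ<-cong _ _ (%ℕ-cong (0ℤ ℤ.- + lad (a , b)) (+ b) (begin
    + b ℤ.- + a                                        ≡⟨ expand (+ a) (+ b) (+ e) ⟩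
    0ℤ ℤ.- (+ a ℤ.+ + e ℤ.* + b) ℤ.+ + b ℤ.* (1ℤ ℤ.+ + e)
      ≡⟨ cong (λ t → 0ℤ ℤ.- (+ a ℤ.+ t) ℤ.+ + b ℤ.* + ℓ) (ℤ.pos-* e b) ⟨
    0ℤ ℤ.- + lad (a , b) ℤ.+ + b ℤ.* + ℓ               ∎)) _ _
    where
    open ≡-Reasoning
    expand : ∀ a b e →
      b ℤ.- a ≡ 0ℤ ℤ.- (a ℤ.+ e ℤ.* b) ℤ.+ b ℤ.* (1ℤ ℤ.+ e)
    expand = ℤ-Solver.solve-∀

  color-+ℓ : ∀ m → color (m + ℓ) ≡ color m
  color-+ℓ m = Fin.fromℕ<-cong _ _ (%ℕ-cong (0ℤ ℤ.- + m) -1ℤ (expand (+ m) (+ ℓ))) _ _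
    where
    expand : ∀ m l → 0ℤ ℤ.- (m ℤ.+ l) ≡ 0ℤ ℤ.- m ℤ.+ -1ℤ ℤ.* l
    expand = ℤ-Solver.solve-∀

  -- The numbers -m and -n have equal remainders, so they differ by a multiple of ℓ. Comparing their
  -- quotients reverses the inequality.
  color-gap : ∀ {m n} → color m ≡ color n → m < n → m + ℓ ≤ n
  color-gap {m} {n} same m<n = ℤ.drop‿+≤+ (ℤ.neg-cancel-≤ (begin
    ℤ.- + n                            ≡⟨ form n ⟩
    + r n ℤ.+ q n ℤ.* + ℓ              ≡⟨ cong (λ t → + t ℤ.+ q n ℤ.* + ℓ) r≡ ⟨
    + r m ℤ.+ q n ℤ.* + ℓ              ≡⟨ shift (+ r m) (q n) (+ ℓ) ⟩
    + r m ℤ.+ ℤ.suc (q n) ℤ.* + ℓ ℤ.- + ℓ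
      ≤⟨ ℤ.+-monoˡ-≤ (ℤ.- + ℓ) (ℤ.+-monoʳ-≤ (+ r m)
           (ℤ.*-monoʳ-≤-nonNeg (+ ℓ) (ℤ.i<j⇒suc[i]≤j q-<))) ⟩
    + r m ℤ.+ q m ℤ.* + ℓ ℤ.- + ℓ      ≡⟨ cong (ℤ._- + ℓ) (form m) ⟨
    ℤ.- + m ℤ.- + ℓ                    ≡⟨ ℤ.neg-distrib-+ (+ m) (+ ℓ) ⟨
    ℤ.- + (m + ℓ)                      ∎))
    where
    open ℤ.≤-Reasoning
    r : ℕ → ℕ
    r m = (0ℤ ℤ.- + m) %ℕ ℓ
    q : ℕ → ℤ
    q m = (0ℤ ℤ.- + m) /ℕ ℓ
    r≡ : r m ≡ r n
    r≡ = Fin.fromℕ<-injective _ _ _ _ same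
    form : ∀ m → ℤ.- + m ≡ + r m ℤ.+ q m ℤ.* + ℓ
    form m = trans (sym (ℤ.+-identityˡ _)) (a≡a%ℕn+[a/ℕn]*n (0ℤ ℤ.- + m) ℓ)
    q-< : q n ℤ.< q m
    q-< = ℤ.≰⇒> λ le → ℤ.<⇒≱ (ℤ.neg-mono-< (ℤ.+<+ m<n)) (begin
      ℤ.- + m                   ≡⟨ form m ⟩
      + r m ℤ.+ q m ℤ.* + ℓ     ≤⟨ ℤ.+-monoʳ-≤ (+ r m) (ℤ.*-monoʳ-≤-nonNeg (+ ℓ) le) ⟩
      + r m ℤ.+ q n ℤ.* + ℓ     ≡⟨ cong (λ t → + t ℤ.+ q n ℤ.* + ℓ) r≡ ⟩
      + r n ℤ.+ q n ℤ.* + ℓ     ≡⟨ form n ⟨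
      ℤ.- + n                   ∎)
    shift : ∀ r q l → r ℤ.+ q ℤ.* l ≡ r ℤ.+ (1ℤ ℤ.+ q) ℤ.* l ℤ.- l
    shift = ℤ-Solver.solve-∀

  color-near : ∀ {m} k → 0 < k → k < ℓ → color (m + k) ≢ color m
  color-near {m} k pos small eq = ℕ.<⇒≱ small
    (ℕ.+-cancelˡ-≤ m ℓ k (color-gap (sym eq) (ℕ.m<m+n m pos)))

  -- Marks of a partition

  open Cuts lad

  data MarkView (i : Fin ℓ) (μ : Partition) (x : Position) :
                Maybe (Sign × Position) → Set where
    is-minus : residue ℓ x ≡ i → RemoveCriterion μ x → MarkView i μ x (just (minus x))
    is-plus  : residue ℓ x ≡ i → AddCriterion μ x → MarkView i μ x (just (plus x))
    is-none  : (residue ℓ x ≡ i → ¬ RemoveCriterion μ x × ¬ AddCriterion μ x) →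
               MarkView i μ x nothing

  mark-view : ∀ i μ x → MarkView i μ x (mark ℓ i μ x)
  mark-view i μ x with residue ℓ x Fin.≟ i | removable? μ x | addable? μ x
  ... | no ≢i  | _      | _      = is-none (⊥-elim ∘ ≢i)
  ... | yes ≡i | yes r  | _      = is-minus ≡i (removable⇒criterion μ x r)
  ... | yes ≡i | no _   | yes a  = is-plus ≡i (addable⇒criterion μ x a)
  ... | yes ≡i | no ¬r  | no ¬a  =
    is-none λ _ → ¬r ∘ criterion⇒removable μ x , ¬a ∘ criterion⇒addable μ x

  add⇒¬remove : ∀ μ x → AddCriterion μ x → ¬ RemoveCriterion μ x
  add⇒¬remove μ x (p , _) (q , _) = ℕ.1+n≢n (trans q (sym p))

  mark-plus : ∀ {i} μ x → residue ℓ x ≡ i → AddCriterion μ x → mark ℓ i μ x ≡ just (plus x)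
  mark-plus {i} μ x ≡i a with mark ℓ i μ x | mark-view i μ x
  ... | _ | is-minus _ r = ⊥-elim (add⇒¬remove μ x a r)
  ... | _ | is-plus _ _  = refl
  ... | _ | is-none neither   = ⊥-elim (proj₂ (neither ≡i) a)

  mark-minus : ∀ {i} μ x → residue ℓ x ≡ i → RemoveCriterion μ x →
               mark ℓ i μ x ≡ just (minus x)
  mark-minus {i} μ x ≡i r with mark ℓ i μ x | mark-view i μ x
  ... | _ | is-minus _ _ = refl
  ... | _ | is-plus _ a  = ⊥-elim (add⇒¬remove μ x a r)
  ... | _ | is-none neither   = ⊥-elim (proj₁ (neither ≡i) r)

  Marked : Fin ℓ → Partition → Sign × Position → Set
  Marked i μ (plus  x) = color (lad x) ≡ i × AddCriterion μ x
  Marked i μ (minus x) = color (lad x) ≡ i × RemoveCriterion μ x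

  mark-marked : ∀ i μ x {s} → mark ℓ i μ x ≡ just s → Marked i μ s × proj₂ s ≡ x
  mark-marked i μ x eq with mark ℓ i μ x | mark-view i μ x
  mark-marked i μ x refl | _ | is-minus ≡i r = (trans (sym (residue-lad x)) ≡i , r) , refl
  mark-marked i μ x refl | _ | is-plus  ≡i a = (trans (sym (residue-lad x)) ≡i , a) , refl

  cells : Partition → List Position
  cells μ = concatMap (λ a → map (a ,_) (upTo (suc (row μ a)))) (upTo (suc (length (parts μ))))

  marks-marked : ∀ i μ → All (Marked i μ) (marks ℓ i μ)
  marks-marked i μ = go (cells μ)
    where
    go : ∀ xs → All (Marked i μ) (mapMaybe (mark ℓ i μ) xs)
    go [] = []
    go (x ∷ xs) with mark ℓ i μ x in eq
    ... | nothing = go xs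
    ... | just s  = proj₁ (mark-marked i μ x eq) ∷ go xs

  private
    ∈-mapMaybe : ∀ {A B : Set} (f : A → Maybe B) {xs x y} → x ∈ˡ xs → f x ≡ just y →
                 y ∈ˡ mapMaybe f xs
    ∈-mapMaybe f (here refl) eq rewrite eq = here refl
    ∈-mapMaybe f {z ∷ _} (there i) eq with f z
    ... | just _  = there (∈-mapMaybe f i eq)
    ... | nothing = ∈-mapMaybe f i eq

    ∈-cells : ∀ {μ a b} → a ≤ length (parts μ) → b ≤ row μ a → (a , b) ∈ˡ cells μ
    ∈-cells {μ} {a} p q =
      ∈-concatMap⁺ (λ a → map (a ,_) (upTo (suc (row μ a))))
        (lose (∈-upTo⁺ (s≤s p)) (∈-map⁺ (a ,_) (∈-upTo⁺ (s≤s q))))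

  row-pos⇒< : ∀ μ a → 0 < row μ a → a < length (parts μ)
  row-pos⇒< μ a pos = ℕ.≰⇒> λ le → ℕ.<⇒≢ pos (sym (row-end μ a le))

  -- An addable position may lie one row below the last part or one column beyond its row, and
  -- `cells` reaches just that far.
  ∈-marks : ∀ {i μ s} → Marked i μ s → s ∈ˡ marks ℓ i μ
  ∈-marks {i} {μ} {plus (a , b)} (c , add@(eq , above)) =
    ∈-mapMaybe (mark ℓ i μ) (∈-cells {μ} (bound a above) (ℕ.≤-reflexive eq))
      (mark-plus μ _ (trans (residue-lad (a , b)) c) add)
    where
    bound : ∀ a → (∀ c → a ≡ suc c → b < row μ c) → a ≤ length (parts μ)
    bound zero    h = z≤n
    bound (suc c) h = row-pos⇒< μ c (ℕ.≤-<-trans z≤n (h c refl))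
  ∈-marks {i} {μ} {minus (a , b)} (c , rem@(eq , _)) =
    ∈-mapMaybe (mark ℓ i μ)
      (∈-cells {μ} (ℕ.<⇒≤ (row-pos⇒< μ a (ℕ.<-≤-trans ℕ.z<s (ℕ.≤-reflexive eq))))
        (ℕ.<⇒≤ (ℕ.≤-reflexive eq)))
      (mark-minus μ _ (trans (residue-lad (a , b)) c) rem)

  -- From sums over marks to sums over boxes

  boxsum : Partition → (ℕ → ℤ) → ℤ
  boxsum μ H = ∑< (length (parts μ)) λ a → ∑< (row μ a) λ b → H (lad (a , b))

  private
    boxsum-extend : ∀ μ H {n} → length (parts μ) ≤ n →
      ∑< n (λ a → ∑< (row μ a) λ b → H (lad (a , b))) ≡ boxsum μ H
    boxsum-extend μ H le = ∑<-extend _ _ le λ {a} le′ →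
      cong (λ r → ∑< r λ b → H (lad (a , b))) (row-end μ a le′)

  boxsum-grow : ∀ {l x m} → Grow l x m → ∀ H → boxsum m H ≡ boxsum l H ℤ.+ H (lad x)
  boxsum-grow {l} {a , b} {m} g H = begin
    boxsum m H                     ≡⟨ boxsum-extend m H (ℕ.≤-trans (ℕ.m≤n+m _ (a + length (parts l))) (ℕ.n≤1+n _)) ⟨
    ∑< n (rows m)                  ≡⟨ ∑<-update n {rows l} (s≤s (ℕ.≤-trans (ℕ.m≤m+n a _) (ℕ.m≤m+n _ _)))
                                        (λ c ne → cong (λ r → ∑< r λ b → H (lad (c , b))) (g.other c ne))
                                        at-a ⟩
    ∑< n (rows l) ℤ.+ H (lad (a , b))
      ≡⟨ cong (ℤ._+ H (lad (a , b)))
           (boxsum-extend l H (ℕ.≤-trans (ℕ.m≤n+m _ a) (ℕ.≤-trans (ℕ.m≤m+n _ _) (ℕ.n≤1+n _)))) ⟩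
    boxsum l H ℤ.+ H (lad (a , b)) ∎
    where
    open ≡-Reasoning
    module g = Grow g
    -- A number of rows covering l, m and the row a; rows past the last part contribute nothing.
    n = suc (a + length (parts l) + length (parts m))
    rows : Partition → ℕ → ℤ
    rows μ a = ∑< (row μ a) λ b → H (lad (a , b))
    at-a : rows m a ≡ rows l a ℤ.+ H (lad (a , b))
    at-a rewrite g.at-new | g.at-old = refl

  -- Row by row, the contributions of the marks telescope: when the end of row
  -- a + 1 is not addable, row a has the same length and its end is not removable,
  -- and the terms that both would contribute cancel.
  module _ (F : ℕ → ℤ) (i : Fin ℓ) (support : ∀ m → color m ≢ i → F m ≡ 0ℤ) where

    -- F is evaluated at the corners of the rim: an addable position is such a corner itself, and
    -- the corner of a removable box is its diagonal neighbour, ℓ ladders later.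
    weightOf : Sign × Position → ℤ
    weightOf (plus  x) = F (lad x)
    weightOf (minus x) = ℤ.- F (lad x + ℓ)

    -- The alternating sum of F over a box on ladder m and its neighbours to the right (`m + e`), on
    -- the diagonal (`m + ℓ`) and below (`m + 1`). Summed over a diagram it leaves only corners.
    Δ : ℕ → ℤ
    Δ m = (F (m + e) ℤ.- F (suc (m + e))) ℤ.- (F m ℤ.- F (suc m))

    module _ (μ : Partition) where
      private
        r = row μ
        N = length (parts μ)

        -- One condition decides both whether row a has a removable end and whether the end of row a
        -- + 1 is addable.
        corner : ℕ → ℤ
        corner a = ind (r (suc a) <? r a)

        gain loss atRow belowRow : ℕ → ℤ
        atRow a = F (a + e * r a)
        belowRow a = F (suc a + e * r a)
        gain zero    = atRow 0
        gain (suc a) = corner a ℤ.* atRow (suc a)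
        loss a = corner a ℤ.* belowRow a

        value : Position → ℤ
        value x = maybe′ weightOf 0ℤ (mark ℓ i μ x)

        value-none : ∀ a b → ¬ RemoveCriterion μ (a , b) → ¬ AddCriterion μ (a , b) →
                     value (a , b) ≡ 0ℤ
        value-none a b ¬r ¬a with mark ℓ i μ (a , b) | mark-view i μ (a , b)
        ... | _ | is-minus _ r = ⊥-elim (¬r r)
        ... | _ | is-plus  _ a = ⊥-elim (¬a a)
        ... | _ | is-none _    = refl

        value-plus : ∀ a b → AddCriterion μ (a , b) → value (a , b) ≡ F (lad (a , b))
        value-plus a b add with mark ℓ i μ (a , b) | mark-view i μ (a , b)
        ... | _ | is-minus _ rem = ⊥-elim (add⇒¬remove μ (a , b) add rem)
        ... | _ | is-plus  _ _   = refl
        -- An addable position without a mark has another residue, and there F vanishes.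
        ... | _ | is-none neither     = sym (support (lad (a , b)) λ c →
                  proj₂ (neither (trans (residue-lad (a , b)) c)) add)

        value-minus : ∀ a b → RemoveCriterion μ (a , b) →
                      value (a , b) ≡ ℤ.- F (lad (a , b) + ℓ)
        value-minus a b rem with mark ℓ i μ (a , b) | mark-view i μ (a , b)
        ... | _ | is-minus _ _   = refl
        ... | _ | is-plus  _ add = ⊥-elim (add⇒¬remove μ (a , b) add rem)
        ... | _ | is-none neither     = cong ℤ.-_ (sym (support (lad (a , b) + ℓ) λ c → proj₁
                  (neither (trans (residue-lad (a , b)) (trans (sym (color-+ℓ (lad (a , b)))) c))) rem))

        corner-yes : ∀ a t → r (suc a) < r a → corner a ℤ.* t ≡ t
        corner-yes a t lt =
          trans (cong (ℤ._* t) (ind-yes (r (suc a) <? r a) lt)) (ℤ.*-identityˡ t)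

        corner-no : ∀ a t → ¬ r (suc a) < r a → corner a ℤ.* t ≡ 0ℤ
        corner-no a t ≮ = cong (ℤ._* t) (ind-no (r (suc a) <? r a) ≮)

        value-end : ∀ a → value (a , r a) ≡ gain a
        value-end zero    = value-plus 0 (r 0) (refl , λ _ ())
        value-end (suc a) = by (r (suc a) <? r a)
          where
          by : Dec (r (suc a) < r a) → value (suc a , r (suc a)) ≡ gain (suc a)
          by (yes lt) = trans (value-plus (suc a) (r (suc a)) (refl , λ { _ refl → lt }))
                              (sym (corner-yes a (atRow (suc a)) lt))
          by (no ≮)   = trans (value-none (suc a) (r (suc a)) (λ rem → ℕ.1+n≢n (proj₁ rem))
                                (λ add → ≮ (proj₂ add a refl)))
                              (sym (corner-no a (atRow (suc a)) ≮))

        value-last : ∀ a k → r a ≡ suc k → value (a , k) ≡ ℤ.- loss a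
        value-last a k eq = by (r (suc a) <? r a)
          where
          open ≡-Reasoning
          by : Dec (r (suc a) < r a) → value (a , k) ≡ ℤ.- loss a
          by (yes lt) = begin
            value (a , k)              ≡⟨ value-minus a k (sym eq ,
                                            ℕ.≤-pred (ℕ.<-≤-trans lt (ℕ.≤-reflexive eq))) ⟩
            ℤ.- F (lad (a , k) + ℓ)    ≡⟨ cong (ℤ.-_ ∘ F) (lad-diagonal a k) ⟨
            ℤ.- F (suc a + e * suc k)  ≡⟨ cong (λ t → ℤ.- F (suc a + e * t)) eq ⟨
            ℤ.- belowRow a             ≡⟨ cong ℤ.-_ (corner-yes a (belowRow a) lt) ⟨
            ℤ.- loss a                 ∎
          by (no ≮) = trans
            (value-none a k
              (λ rem → ≮ (ℕ.≤-<-trans (proj₂ rem) (ℕ.≤-reflexive (sym eq))))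
              (λ add → ℕ.1+n≢n (trans (sym eq) (sym (proj₁ add)))))
            (sym (cong ℤ.-_ (corner-no a (belowRow a) ≮)))

        value-inner : ∀ a k → suc k < r a → value (a , k) ≡ 0ℤ
        value-inner a k lt = value-none a k (λ rem → ℕ.<⇒≢ lt (proj₁ rem))
          (λ add → ℕ.<⇒≢ (ℕ.<-trans ℕ.≤-refl lt) (proj₁ add))

        value-row : ∀ a → ∑< (suc (r a)) (λ b → value (a , b)) ≡ gain a ℤ.- loss a
        value-row a = trans (cong (ℤ._+_ (∑< (r a) λ b → value (a , b))) (value-end a))
          (trans (cong (ℤ._+ gain a) (inner (r a) refl)) (ℤ.+-comm (ℤ.- loss a) (gain a)))
          where
          inner : ∀ t → r a ≡ t → ∑< t (λ b → value (a , b)) ≡ ℤ.- loss a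
          inner zero eq rewrite eq = refl
          inner (suc k) eq = trans
            (cong₂ ℤ._+_
              (∑<-zero k λ {b} lt → value-inner a b
                (ℕ.<-≤-trans (s≤s lt) (ℕ.≤-reflexive (sym eq))))
              (value-last a k eq))
            (ℤ.+-identityˡ _)

        corner-cancel : ∀ a → gain (suc a) ℤ.- loss a ≡ atRow (suc a) ℤ.- belowRow a
        corner-cancel a with r (suc a) <? r a
        ... | yes _ = cong₂ ℤ._-_ (ℤ.*-identityˡ (atRow (suc a))) (ℤ.*-identityˡ (belowRow a))
        ... | no ≮  = sym (ℤ.i≡j⇒i-j≡0 (cong (λ t → F (suc a + e * t))
                        (ℕ.≤-antisym (row-antitone μ a) (ℕ.≮⇒≥ ≮))))

        -- The loss of row a must be paired with the gain of row a + 1; this shift by one row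
        -- produces the boundary terms.
        rearrange : ∀ n → ∑< (suc n) (λ a → gain a ℤ.- loss a) ≡
          ∑< n (λ a → atRow a ℤ.- belowRow a) ℤ.+ atRow n ℤ.- loss n
        rearrange zero    = sym (ℤ.+-assoc 0ℤ (atRow 0) (ℤ.- loss 0))
        rearrange (suc n) = begin
          ∑< (suc n) (λ a → gain a ℤ.- loss a) ℤ.+ (gain (suc n) ℤ.- loss (suc n))
            ≡⟨ cong (ℤ._+ (gain (suc n) ℤ.- loss (suc n))) (rearrange n) ⟩
          (S ℤ.+ atRow n ℤ.- loss n) ℤ.+ (gain (suc n) ℤ.- loss (suc n))
            ≡⟨ move S (atRow n) (loss n) (gain (suc n)) (loss (suc n)) ⟩
          (S ℤ.+ atRow n ℤ.+ (gain (suc n) ℤ.- loss n)) ℤ.- loss (suc n)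
            ≡⟨ cong (λ t → S ℤ.+ atRow n ℤ.+ t ℤ.- loss (suc n)) (corner-cancel n) ⟩
          (S ℤ.+ atRow n ℤ.+ (atRow (suc n) ℤ.- belowRow n)) ℤ.- loss (suc n)
            ≡⟨ regroup S (atRow n) (atRow (suc n)) (belowRow n) (loss (suc n)) ⟩
          (S ℤ.+ (atRow n ℤ.- belowRow n)) ℤ.+ atRow (suc n) ℤ.- loss (suc n) ∎
          where
          open ≡-Reasoning
          S = ∑< n (λ a → atRow a ℤ.- belowRow a)
          move : ∀ s a l g m →
            (s ℤ.+ a ℤ.- l) ℤ.+ (g ℤ.- m) ≡ (s ℤ.+ a ℤ.+ (g ℤ.- l)) ℤ.- m
          move = ℤ-Solver.solve-∀
          regroup : ∀ s a b c m →
            (s ℤ.+ a ℤ.+ (b ℤ.- c)) ℤ.- m ≡ (s ℤ.+ (a ℤ.- c)) ℤ.+ b ℤ.- m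
          regroup = ℤ-Solver.solve-∀

        G : ℕ → ℤ
        G m = F m ℤ.- F (suc m)

        -- Moving one column to the right raises `lad` by e, so `Δ` is the increment of G along the
        -- row.
        row-sum : ∀ a → atRow a ℤ.- belowRow a ≡ G a ℤ.+ ∑< (r a) (λ b → Δ (lad (a , b)))
        row-sum a = sym (begin
          G a ℤ.+ ∑< (r a) (λ b → Δ (lad (a , b)))
            ≡⟨ cong₂ ℤ._+_ (cong G (sym (trans (cong (_+_ a) (ℕ.*-zeroʳ e)) (ℕ.+-identityʳ a))))
                 (∑<-cong (r a) λ {b} _ → cong (λ m → G m ℤ.- G (lad (a , b))) (sym (lad-right a b))) ⟩
          G (lad (a , 0)) ℤ.+ ∑< (r a) (λ b → G (lad (a , suc b)) ℤ.- G (lad (a , b)))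
            ≡⟨ ∑<-telescope (r a) (λ b → G (lad (a , b))) ⟩
          G (lad (a , r a)) ∎)
          where open ≡-Reasoning

        ∑G : ∑< N G ≡ F 0 ℤ.- F N
        ∑G = begin
          ∑< N G                                            ≡⟨ add-sub (F 0) (∑< N G) ⟩
          F 0 ℤ.- (F 0 ℤ.+ ℤ.- ∑< N G)
            ≡⟨ cong (λ t → F 0 ℤ.- (F 0 ℤ.+ t)) (neg N) ⟩
          F 0 ℤ.- (F 0 ℤ.+ ∑< N (λ k → F (suc k) ℤ.- F k))
            ≡⟨ cong (ℤ._-_ (F 0)) (∑<-telescope N F) ⟩
          F 0 ℤ.- F N ∎
          where
          open ≡-Reasoning
          add-sub : ∀ x y → y ≡ x ℤ.- (x ℤ.+ ℤ.- y)
          add-sub = ℤ-Solver.solve-∀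
          neg-step : ∀ s x y → ℤ.- (s ℤ.+ (x ℤ.- y)) ≡ ℤ.- s ℤ.+ (y ℤ.- x)
          neg-step = ℤ-Solver.solve-∀
          neg : ∀ n → ℤ.- ∑< n G ≡ ∑< n (λ k → F (suc k) ℤ.- F k)
          neg zero    = refl
          neg (suc n) = trans (neg-step (∑< n G) (F n) (F (suc n)))
            (cong (ℤ._+ (F (suc n) ℤ.- F n)) (neg n))

      ∑-weightOf : ∑ weightOf (marks ℓ i μ) ≡ F 0 ℤ.+ boxsum μ Δ
      ∑-weightOf = begin
        ∑ weightOf (marks ℓ i μ)
          ≡⟨ ∑-mapMaybe weightOf (mark ℓ i μ) (cells μ) ⟩
        ∑ value (cells μ)
          ≡⟨ ∑-concatMap value (λ a → map (a ,_) (upTo (suc (r a)))) (upTo (suc N)) ⟩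
        ∑ (λ a → ∑ value (map (a ,_) (upTo (suc (r a))))) (upTo (suc N))
          ≡⟨ ∑-upTo _ (suc N) ⟩
        ∑< (suc N) (λ a → ∑ value (map (a ,_) (upTo (suc (r a)))))
          ≡⟨ ∑<-cong (suc N) (λ {a} _ → trans (∑-map value (a ,_) (upTo (suc (r a))))
               (trans (∑-upTo _ (suc (r a))) (value-row a))) ⟩
        ∑< (suc N) (λ a → gain a ℤ.- loss a)
          ≡⟨ rearrange N ⟩
        ∑< N (λ a → atRow a ℤ.- belowRow a) ℤ.+ atRow N ℤ.- loss N
          ≡⟨ cong₂ (λ s t → s ℤ.+ t ℤ.- loss N)
               (trans (∑<-cong N λ {a} _ → row-sum a)
                 (∑<-+ N G (λ a → ∑< (r a) (λ b → Δ (lad (a , b))))))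
               atRowN ⟩
        (∑< N G ℤ.+ boxsum μ Δ) ℤ.+ F N ℤ.- loss N
          -- Down the first column G telescopes to F 0 - F N, and the corner at the empty row N
          -- restores F N.
          ≡⟨ cong₂ (λ s t → (s ℤ.+ boxsum μ Δ) ℤ.+ F N ℤ.- t) ∑G lossN ⟩
        ((F 0 ℤ.- F N) ℤ.+ boxsum μ Δ) ℤ.+ F N ℤ.- 0ℤ
          ≡⟨ final (F 0) (F N) (boxsum μ Δ) ⟩
        F 0 ℤ.+ boxsum μ Δ ∎
        where
        open ≡-Reasoning
        atRowN : atRow N ≡ F N
        atRowN rewrite row-end μ N ℕ.≤-refl | ℕ.*-zeroʳ d | ℕ.+-identityʳ N = refl
        lossN : loss N ≡ 0ℤ
        lossN rewrite row-end μ N ℕ.≤-refl = refl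
        final : ∀ x y s → ((x ℤ.- y) ℤ.+ s) ℤ.+ y ℤ.- 0ℤ ≡ x ℤ.+ s
        final = ℤ-Solver.solve-∀

  infix 4 _∼_

  -- Equivalently, l and m have the same number of boxes on every ladder.
  _∼_ : Partition → Partition → Set
  l ∼ m = ∀ H → boxsum l H ≡ boxsum m H

  ∼-grow : ∀ {l m l′ m′ x y} → Grow l x l′ → Grow m y m′ → lad x ≡ lad y → l ∼ m → l′ ∼ m′
  ∼-grow {l} {m} {l′} {m′} {x} {y} g h same eq H = begin
    boxsum l′ H                ≡⟨ boxsum-grow g H ⟩
    boxsum l H ℤ.+ H (lad x)   ≡⟨ cong₂ (λ s n → s ℤ.+ H n) (eq H) same ⟩
    boxsum m H ℤ.+ H (lad y)   ≡⟨ boxsum-grow h H ⟨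
    boxsum m′ H                ∎
    where open ≡-Reasoning

  ∼-shrink : ∀ {l m l′ m′ x y} → Grow l x l′ → Grow m y m′ → lad x ≡ lad y → l′ ∼ m′ → l ∼ m
  ∼-shrink {l} {m} {l′} {m′} {x} {y} g h same eq H = begin
    boxsum l H                              ≡⟨ cancel (boxsum l H) (H (lad x)) ⟨
    boxsum l H ℤ.+ H (lad x) ℤ.- H (lad x)  ≡⟨ cong (ℤ._- H (lad x)) (boxsum-grow g H) ⟨
    boxsum l′ H ℤ.- H (lad x)               ≡⟨ cong₂ (λ s n → s ℤ.- H n) (eq H) same ⟩
    boxsum m′ H ℤ.- H (lad y)               ≡⟨ cong (ℤ._- H (lad y)) (boxsum-grow h H) ⟩
    boxsum m H ℤ.+ H (lad y) ℤ.- H (lad y)  ≡⟨ cancel (boxsum m H) (H (lad y)) ⟩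
    boxsum m H                              ∎
    where
    open ≡-Reasoning
    cancel : ∀ s t → s ℤ.+ t ℤ.- t ≡ s
    cancel = ℤ-Solver.solve-∀

  size : Partition → ℤ
  size μ = boxsum μ λ _ → 1ℤ

  size-pos : ∀ μ → 0 < row μ 0 → 0ℤ ℤ.< size μ
  size-pos μ pos = ∑<-pos (length (parts μ)) (λ a → ∑<-nonneg (row μ a) λ _ → ℤ.+≤+ z≤n)
    (row-pos⇒< μ 0 pos) (∑<-pos (row μ 0) (λ _ → ℤ.+≤+ z≤n) pos (ℤ.+<+ ℕ.z<s))

  row₀-zero : ∀ μ → row μ 0 ≡ 0 → μ ≡ ∅
  row₀-zero μ eq = row-injective (antitone-zero (row μ) (row-antitone μ) eq)

  size-zero : ∀ μ → size μ ℤ.≤ 0ℤ → μ ≡ ∅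
  size-zero μ le with row μ 0 in eq
  ... | zero  = row₀-zero μ eq
  ... | suc _ = ⊥-elim (ℤ.<⇒≱ (size-pos μ (subst (0 <_) (sym eq) ℕ.z<s)) le)

  -- T i n μ is the height that the i-signature reaches just after its + on ladder n.
  T : Fin ℓ → ℕ → Partition → ℤ
  T i n μ = ∑ (val n) (marks ℓ i μ)

  module _ (i : Fin ℓ) (n : ℕ) where

    -- The function F for which `weightOf` counts the + on ladders up to n and, by the shift of ℓ,
    -- the - on ladders before n.
    cutoff : ℕ → ℤ
    cutoff m = ind (color m Fin.≟ i) ℤ.* ind (m ≤? n)

    cutoff-off : ∀ m → color m ≢ i → cutoff m ≡ 0ℤ
    cutoff-off m ≢i = cong (ℤ._* ind (m ≤? n)) (ind-no (color m Fin.≟ i) ≢i)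

    cutoff-on : ∀ m → color m ≡ i → cutoff m ≡ ind (m ≤? n)
    cutoff-on m ≡i = trans (cong (ℤ._* ind (m ≤? n)) (ind-yes (color m Fin.≟ i) ≡i))
                             (ℤ.*-identityˡ _)

    private
      val-weightOf : color n ≡ i → ∀ {μ} s → Marked i μ s →
                     val n s ≡ weightOf cutoff i cutoff-off s
      val-weightOf n≡i (plus x) (c , _) =
        trans (ℤ.*-identityʳ _) (sym (cutoff-on (lad x) c))
      val-weightOf n≡i (minus x) (c , _) = begin
        ind (lad x <? n) ℤ.* -1ℤ      ≡⟨ neg (ind (lad x <? n)) ⟩
        -- Both ladders have residue i, so coming before n means coming at least ℓ before it.
        ℤ.- ind (lad x <? n)          ≡⟨ cong ℤ.-_ (ind-⇔ (lad x <? n) (lad x + ℓ ≤? n)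
                                           (color-gap (trans c (sym n≡i)))
                                           (ℕ.<-≤-trans (ℕ.m<m+n (lad x) ℕ.z<s))) ⟩
        ℤ.- ind (lad x + ℓ ≤? n)      ≡⟨ cong ℤ.-_ (cutoff-on (lad x + ℓ) (trans (color-+ℓ (lad x)) c)) ⟨
        ℤ.- cutoff (lad x + ℓ)        ∎
        where
        open ≡-Reasoning
        neg : ∀ t → t ℤ.* -1ℤ ≡ ℤ.- t
        neg = ℤ-Solver.solve-∀

    T-boxsum : color n ≡ i → ∀ μ →
               T i n μ ≡ cutoff 0 ℤ.+ boxsum μ (Δ cutoff i cutoff-off)
    T-boxsum n≡i μ = trans
      (∑-cong (All.map (λ {s} → val-weightOf n≡i {μ} s) (marks-marked i μ)))
      (∑-weightOf cutoff i cutoff-off μ)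

    T-cong : color n ≡ i → ∀ {l m} → l ∼ m → T i n l ≡ T i n m
    T-cong n≡i {l} {m} eq = trans (T-boxsum n≡i l)
      (trans (cong (ℤ._+_ (cutoff 0)) (eq (Δ cutoff i cutoff-off))) (sym (T-boxsum n≡i m)))

    -- Of the four ladders p, p + 1, p + e and p + ℓ that `Δ` involves for a box on ladder p, only
    -- the first and the last have residue i.
    T-grow : color n ≡ i → ∀ {l x m} → Grow l x m → color (lad x) ≡ i →
             T i n m ≡ T i n l ℤ.- ind (lad x ≤? n) ℤ.- ind (lad x + ℓ ≤? n)
    T-grow n≡i {l} {x} {m} g c = begin
      T i n m
        ≡⟨ T-boxsum n≡i m ⟩
      cutoff 0 ℤ.+ boxsum m D
        ≡⟨ cong (ℤ._+_ (cutoff 0)) (boxsum-grow g D) ⟩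
      cutoff 0 ℤ.+ (boxsum l D ℤ.+ D p)
        ≡⟨ ℤ.+-assoc (cutoff 0) (boxsum l D) (D p) ⟨
      cutoff 0 ℤ.+ boxsum l D ℤ.+ D p
        ≡⟨ cong₂ ℤ._+_ (sym (T-boxsum n≡i l)) D-at ⟩
      T i n l ℤ.+ ((0ℤ ℤ.- ind (p + ℓ ≤? n)) ℤ.- (ind (p ≤? n) ℤ.- 0ℤ))
        ≡⟨ tidy (T i n l) (ind (p + ℓ ≤? n)) (ind (p ≤? n)) ⟩
      T i n l ℤ.- ind (p ≤? n) ℤ.- ind (p + ℓ ≤? n) ∎
      where
      open ≡-Reasoning
      p = lad x
      D = Δ cutoff i cutoff-off
      tidy : ∀ t u v → t ℤ.+ ((0ℤ ℤ.- u) ℤ.- (v ℤ.- 0ℤ)) ≡ t ℤ.- v ℤ.- u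
      tidy = ℤ-Solver.solve-∀
      off : ∀ k → 0 < k → k < ℓ → cutoff (p + k) ≡ 0ℤ
      off k pos lt = cutoff-off (p + k) λ eq → color-near {p} k pos lt (trans eq (sym c))
      D-at : D p ≡ (0ℤ ℤ.- ind (p + ℓ ≤? n)) ℤ.- (ind (p ≤? n) ℤ.- 0ℤ)
      D-at = cong₂ ℤ._-_
        (cong₂ ℤ._-_ (off e ℕ.z<s ℕ.≤-refl)
          (trans (cong cutoff (sym (ℕ.+-suc p e))) (cutoff-on (p + ℓ) (trans (color-+ℓ p) c))))
        (cong₂ ℤ._-_ (cutoff-on p c)
          (trans (cong cutoff (sym (ℕ.+-comm p 1))) (off 1 ℕ.z<s (s≤s (s≤s z≤n)))))

  -- First and last maxima of the heights

  record FirstMax (i : Fin ℓ) (n : ℕ) (μ : Partition) : Set where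
    field
      onto  : color n ≡ i
      pos   : 0ℤ ℤ.< T i n μ
      left  : ∀ {m} → color m ≡ i → m < n → T i m μ ℤ.< T i n μ
      right : ∀ {m} → color m ≡ i → n < m → T i m μ ℤ.≤ T i n μ

  -- What `FirstMax` becomes once the box is added. The maximum drops by one, so 0 is allowed, and
  -- the strict inequality changes sides.
  record LastMax (i : Fin ℓ) (n : ℕ) (μ : Partition) : Set where
    field
      onto   : color n ≡ i
      nonneg : 0ℤ ℤ.≤ T i n μ
      left   : ∀ {m} → color m ≡ i → m < n → T i m μ ℤ.≤ T i n μ
      right  : ∀ {m} → color m ≡ i → n < m → T i m μ ℤ.< T i n μ

  FirstMax-unique : ∀ {i n n′ l m} → l ∼ m → FirstMax i n l → FirstMax i n′ m → n ≡ n′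
  FirstMax-unique {i} {n} {n′} {l} {m} eq F F′ with ℕ.<-cmp n n′
  ... | tri≈ _ refl _ = refl
  ... | tri< lt _ _   = ⊥-elim (ℤ.<⇒≱ (F′.left F.onto lt)
          (subst₂ ℤ._≤_ (T-cong i n′ F′.onto eq) (T-cong i n F.onto eq) (F.right F′.onto lt)))
    where
    module F  = FirstMax F
    module F′ = FirstMax F′
  ... | tri> _ _ lt   = ⊥-elim (ℤ.<⇒≱ (F.left F′.onto lt)
          (subst₂ ℤ._≤_ (sym (T-cong i n F.onto eq)) (sym (T-cong i n′ F′.onto eq)) (F′.right F.onto lt)))
    where
    module F  = FirstMax F
    module F′ = FirstMax F′

  LastMax-cong : ∀ {i n l m} → l ∼ m → LastMax i n l → LastMax i n m
  LastMax-cong {i} {n} eq L = record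
    { onto   = onto
    ; nonneg = subst (0ℤ ℤ.≤_) n≡ nonneg
    ; left   = λ {k} c lt → subst₂ ℤ._≤_ (T-cong i k c eq) n≡ (left c lt)
    ; right  = λ {k} c lt → subst₂ ℤ._<_ (T-cong i k c eq) n≡ (right c lt) }
    where
    open LastMax L
    n≡ = T-cong i n onto eq

  module _ {l m : Partition} {x : Position} (g : Grow l x m) where
    private n = lad x

    T-grow-< : ∀ {i k} → color k ≡ i → color n ≡ i → k < n → T i k m ≡ T i k l
    T-grow-< {i} {k} ck cn lt = begin
      T i k m                                                ≡⟨ T-grow i k ck g cn ⟩
      T i k l ℤ.- ind (n ≤? k) ℤ.- ind (n + ℓ ≤? k)
        ≡⟨ cong₂ (λ s t → T i k l ℤ.- s ℤ.- t) (ind-no (n ≤? k) (ℕ.<⇒≱ lt))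
             (ind-no (n + ℓ ≤? k) λ le → ℕ.<⇒≱ lt (ℕ.≤-trans (ℕ.m≤m+n n ℓ) le)) ⟩
      T i k l ℤ.- 0ℤ ℤ.- 0ℤ                                  ≡⟨ tidy (T i k l) ⟩
      T i k l                                                ∎
      where
      open ≡-Reasoning
      tidy : ∀ t → t ℤ.- 0ℤ ℤ.- 0ℤ ≡ t
      tidy = ℤ-Solver.solve-∀

    T-grow-≡ : ∀ {i} → color n ≡ i → T i n l ≡ ℤ.suc (T i n m)
    T-grow-≡ {i} cn = begin
      T i n l                                                ≡⟨ tidy (T i n l) ⟩
      ℤ.suc (T i n l ℤ.- 1ℤ ℤ.- 0ℤ)
        ≡⟨ cong ℤ.suc (cong₂ (λ s t → T i n l ℤ.- s ℤ.- t) (ind-yes (n ≤? n) ℕ.≤-refl)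
             (ind-no (n + ℓ ≤? n) (ℕ.<⇒≱ (ℕ.m<m+n n ℕ.z<s)))) ⟨
      ℤ.suc (T i n l ℤ.- ind (n ≤? n) ℤ.- ind (n + ℓ ≤? n))  ≡⟨ cong ℤ.suc (T-grow i n cn g cn) ⟨
      ℤ.suc (T i n m)                                        ∎
      where
      open ≡-Reasoning
      tidy : ∀ t → t ≡ 1ℤ ℤ.+ (t ℤ.- 1ℤ ℤ.- 0ℤ)
      tidy = ℤ-Solver.solve-∀

    T-grow-> : ∀ {i k} → color k ≡ i → color n ≡ i → n < k →
               T i k l ≡ ℤ.suc (ℤ.suc (T i k m))
    T-grow-> {i} {k} ck cn lt = begin
      T i k l                                                ≡⟨ tidy (T i k l) ⟩
      ℤ.suc (ℤ.suc (T i k l ℤ.- 1ℤ ℤ.- 1ℤ))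
        ≡⟨ cong (ℤ.suc ∘ ℤ.suc) (cong₂ (λ s t → T i k l ℤ.- s ℤ.- t) (ind-yes (n ≤? k) (ℕ.<⇒≤ lt))
             (ind-yes (n + ℓ ≤? k) (color-gap (trans cn (sym ck)) lt))) ⟨
      ℤ.suc (ℤ.suc (T i k l ℤ.- ind (n ≤? k) ℤ.- ind (n + ℓ ≤? k)))
        ≡⟨ cong (ℤ.suc ∘ ℤ.suc) (T-grow i k ck g cn) ⟨
      ℤ.suc (ℤ.suc (T i k m))                                ∎
      where
      open ≡-Reasoning
      tidy : ∀ t → t ≡ 1ℤ ℤ.+ (1ℤ ℤ.+ (t ℤ.- 1ℤ ℤ.- 1ℤ))
      tidy = ℤ-Solver.solve-∀

    private
      suc-cancel-≤ : ∀ {s t} → ℤ.suc s ℤ.≤ ℤ.suc t → s ℤ.≤ t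
      suc-cancel-≤ {s} {t} le = subst₂ ℤ._≤_ (pred s) (pred t) (ℤ.+-monoʳ-≤ -1ℤ le)
        where
        pred : ∀ t → -1ℤ ℤ.+ (1ℤ ℤ.+ t) ≡ t
        pred = ℤ-Solver.solve-∀

      <-suc : ∀ {s t} → s ℤ.≤ t → s ℤ.< ℤ.suc t
      <-suc le = ℤ.suc[i]≤j⇒i<j (ℤ.suc-mono le)

    FirstMax⇒LastMax : ∀ {i} → FirstMax i n l → LastMax i n m
    FirstMax⇒LastMax {i} F = record
      { onto   = onto
      ; nonneg = suc-cancel-≤ (subst (1ℤ ℤ.≤_) (T-grow-≡ onto) (ℤ.i<j⇒suc[i]≤j pos))
      ; left   = λ {k} c lt → suc-cancel-≤ (subst₂ ℤ._≤_ (cong ℤ.suc (sym (T-grow-< c onto lt)))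
                   (T-grow-≡ onto) (ℤ.i<j⇒suc[i]≤j (left c lt)))
      ; right  = λ {k} c lt → ℤ.suc[i]≤j⇒i<j (suc-cancel-≤
                   (subst₂ ℤ._≤_ (T-grow-> c onto lt) (T-grow-≡ onto) (right c lt))) }
      where open FirstMax F

    LastMax⇒FirstMax : ∀ {i} → LastMax i n m → FirstMax i n l
    LastMax⇒FirstMax {i} L = record
      { onto  = onto
      ; pos   = subst (0ℤ ℤ.<_) (sym (T-grow-≡ onto)) (<-suc nonneg)
      ; left  = λ {k} c lt → subst₂ ℤ._<_ (T-grow-< c onto lt) (sym (T-grow-≡ onto)) (<-suc (left c lt))
      ; right = λ {k} c lt → subst₂ ℤ._≤_ (sym (T-grow-> c onto lt)) (sym (T-grow-≡ onto))
                  (ℤ.suc-mono (ℤ.i<j⇒suc[i]≤j (right c lt))) }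
      where open LastMax L

  HasAdd HasRemove : Partition → ℕ → Set
  HasAdd    μ n = ∃ λ x → AddCriterion μ x × lad x ≡ n
  HasRemove μ n = ∃ λ x → RemoveCriterion μ x × lad x ≡ n

  module _ {i : Fin ℓ} {n : ℕ} (n≡i : color n ≡ i) (μ : Partition) where

    private
      OnLadder : Sign → ℕ → Sign × Position → Set
      OnLadder σ n s = proj₁ s ≡ σ × lad (proj₂ s) ≡ n

      onLadder? : ∀ σ n → Decidable (OnLadder σ n)
      onLadder? σ n s = (proj₁ s Sign.≟ σ) ×-dec (lad (proj₂ s) ≟ n)

      some-remove : Any (OnLadder Sign.- n) (marks ℓ i μ) → HasRemove μ n
      some-remove any with find any
      ... | minus x , s∈ , refl , eq = x , proj₂ (All.lookup (marks-marked i μ) s∈) , eq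

      some-add : Any (OnLadder Sign.+ (n + ℓ)) (marks ℓ i μ) → HasAdd μ (n + ℓ)
      some-add any with find any
      ... | plus x , s∈ , refl , eq = x , proj₂ (All.lookup (marks-marked i μ) s∈) , eq

      ind-mono : ∀ {P Q : Set} (p : Dec P) (q : Dec Q) → (P → Q) → ind p ℤ.≤ ind q
      ind-mono (yes a) q f = ℤ.≤-reflexive (sym (ind-yes q (f a)))
      ind-mono (no _)  q f = ind-nonneg q

      flip-mono : ∀ {s t} → s ℤ.≤ t → t ℤ.* -1ℤ ℤ.≤ s ℤ.* -1ℤ
      flip-mono = ℤ.*-monoʳ-≤-nonPos -1ℤ

      -- No ladder of residue i lies strictly between n and n + ℓ, so passing from the one to the
      -- other only adds the + on n + ℓ and the - on n to the count.
      rise : ¬ Any (OnLadder Sign.- n) (marks ℓ i μ) →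
             All (λ s → val n s ℤ.≤ val (n + ℓ) s) (marks ℓ i μ)
      rise none = All.tabulate λ {s} s∈ → term s s∈ (All.lookup (marks-marked i μ) s∈)
        where
        term : ∀ s → s ∈ˡ marks ℓ i μ → Marked i μ s → val n s ℤ.≤ val (n + ℓ) s
        term (plus x) s∈ _ = ℤ.*-monoʳ-≤-nonNeg 1ℤ
          (ind-mono (lad x ≤? n) (lad x ≤? n + ℓ) (λ le → ℕ.≤-trans le (ℕ.m≤m+n n ℓ)))
        term (minus x) s∈ (c , _) = flip-mono
          (ind-mono (lad x <? n + ℓ) (lad x <? n) λ lt → ℕ.≰⇒> λ le →
            ℕ.<⇒≱ lt (color-gap (trans n≡i (sym c))
              (ℕ.≤∧≢⇒< le λ eq → none (lose s∈ (refl , sym eq)))))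

      fall : ¬ Any (OnLadder Sign.+ (n + ℓ)) (marks ℓ i μ) →
             All (λ s → val (n + ℓ) s ℤ.≤ val n s) (marks ℓ i μ)
      fall none = All.tabulate λ {s} s∈ → term s s∈ (All.lookup (marks-marked i μ) s∈)
        where
        term : ∀ s → s ∈ˡ marks ℓ i μ → Marked i μ s → val (n + ℓ) s ℤ.≤ val n s
        term (plus x) s∈ (c , _) = ℤ.*-monoʳ-≤-nonNeg 1ℤ
          (ind-mono (lad x ≤? n + ℓ) (lad x ≤? n) λ le → ℕ.≮⇒≥ λ lt →
            none (lose s∈ (refl , ℕ.≤-antisym le (color-gap (trans n≡i (sym c)) lt))))
        term (minus x) s∈ _ = flip-mono
          (ind-mono (lad x <? n) (lad x <? n + ℓ) λ lt → ℕ.<-≤-trans lt (ℕ.m≤m+n n ℓ))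

    remove-if-drop : T i (n + ℓ) μ ℤ.< T i n μ → HasRemove μ n
    remove-if-drop lt with Any.any? (onLadder? Sign.- n) (marks ℓ i μ)
    ... | yes any = some-remove any
    ... | no none = ⊥-elim (ℤ.<⇒≱ lt (∑-mono (rise none)))

    remove-if-add : T i (n + ℓ) μ ℤ.≤ T i n μ → HasAdd μ (n + ℓ) → HasRemove μ n
    remove-if-add le (x , add , eq) with Any.any? (onLadder? Sign.- n) (marks ℓ i μ)
    ... | yes any = some-remove any
    ... | no none = ⊥-elim (ℤ.<⇒≱ (∑-mono-< (rise none)
            (∈-marks {i} {μ} {plus x} (trans (cong color eq) (trans (color-+ℓ n) n≡i) , add))
            (subst₂ ℤ._<_ (sym (val-out (plus x) λ le → ℕ.<⇒≱ (ℕ.m<m+n n ℕ.z<s)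
                (ℕ.≤-trans (ℕ.≤-reflexive (sym eq)) le)))
              (sym (val-in (plus x) (ℕ.≤-reflexive eq))) (ℤ.+<+ ℕ.z<s))) le)

    add-if-remove : T i n μ ℤ.≤ T i (n + ℓ) μ → HasRemove μ n → HasAdd μ (n + ℓ)
    add-if-remove le (x , rem , eq) with Any.any? (onLadder? Sign.+ (n + ℓ)) (marks ℓ i μ)
    ... | yes any = some-add any
    ... | no none = ⊥-elim (ℤ.<⇒≱ (∑-mono-< (fall none)
            (∈-marks {i} {μ} {minus x} (trans (cong color eq) n≡i , rem))
            (subst₂ ℤ._<_
              (sym (val-in (minus x) (ℕ.≤-<-trans (ℕ.≤-reflexive eq) (ℕ.m<m+n n ℕ.z<s))))
              (sym (val-out (minus x) λ lt → ℕ.<⇒≢ lt eq)) ℤ.-<+)) le)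

  -- The argument common to both crystals

  data Generated (f : Fin ℓ → Partition → Maybe Partition) : Partition → Set where
    start : Generated f ∅
    next  : ∀ i {μ ν} → Generated f μ → f i μ ≡ just ν → Generated f ν

  -- What the two crystals have in common.  The relation _⊑_ on rows is the order in
  -- which the words read each ladder.
  record Model : Set₁ where
    field
      Class   : Partition → Set
      word    : Fin ℓ → Partition → Word
      word-↭  : ∀ i μ → word i μ ↭ marks ℓ i μ
      _⊑_     : ℕ → ℕ → Set
      ⊑-refl  : ∀ {a} → a ⊑ a
      sorted  : ∀ i {μ} → Class μ → AllPairs Before (word i μ)
      by-rows : ∀ i {μ} → Class μ → AllPairs (λ s t →
        lad (proj₂ s) ≡ lad (proj₂ t) → proj₁ (proj₂ s) ⊑ proj₁ (proj₂ t)) (word i μ)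
      class-∅ : Class ∅
      -- The premises are what the choice of x provides: it is read last among the + of its ladder,
      -- and since T does not increase to the next ladder of its residue, a + there must be offset
      -- by a - on the ladder of x.
      class-grow : ∀ {l x m} → Class l → Grow l x m →
        (∀ y → AddCriterion l y → lad y ≡ lad x → proj₁ y ⊑ proj₁ x) →
        (HasAdd l (lad x + ℓ) → HasRemove l (lad x)) → Class m
      -- Dually, x is read first among the - of its ladder, and since T does not decrease from the
      -- preceding ladder of its residue, a - there must be offset by a + on the ladder of x.
      class-shrink : ∀ {l x m} → Class m → Grow l x m →
        (∀ y → RemoveCriterion m y → lad y ≡ lad x → proj₁ x ⊑ proj₁ y) →
        (∀ {n} → n + ℓ ≡ lad x → HasRemove m n → HasAdd m (lad x)) → Class l
      -- T only yields the ladder of a box; this recovers the box itself.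
      class-unique : ∀ {l x m y n} → Grow l x m → Grow l y n → Class m → Class n →
        lad x ≡ lad y → x ≡ y

    f : Fin ℓ → Partition → Maybe Partition
    f i μ = addRightmost μ (word i μ)

    private
      ∑-word : ∀ i n μ → ∑ (val n) (word i μ) ≡ T i n μ
      ∑-word i n μ = ∑-↭ (val n) (word-↭ i μ)

      ∈-word : ∀ {i μ s} → Marked i μ s → s ∈ˡ word i μ
      ∈-word {i} {μ} {s} p = ∈-resp-↭ (↭-sym (word-↭ i μ)) (∈-marks {i} {μ} {s} p)

      word-marked : ∀ {i μ s} → s ∈ˡ word i μ → Marked i μ s
      word-marked {i} {μ} s∈ = All.lookup (marks-marked i μ) (∈-resp-↭ (word-↭ i μ) s∈)

    record Good (i : Fin ℓ) (l : Partition) (x : Position) (m : Partition) : Set where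
      field
        grow    : Grow l x m
        first   : FirstMax i (lad x) l
        extreme : ∀ y → AddCriterion l y → lad y ≡ lad x → proj₁ y ⊑ proj₁ x

    private
      good : ∀ {i l x m k} → Class l → Grow l x m → Below (+ suc k) (word i l) →
             FirstPeak (+ suc k) x (word i l) → Good i l x m
      good {i} {l} {x} {m} {k} cl g below peak@(u , v , eq , top , _) = record
        { grow  = g
        ; first = record
          { onto  = onto
          ; pos   = subst (0ℤ ℤ.<_) (sym Tx) (ℤ.+<+ ℕ.z<s)
          ; left  = λ {n} _ lt → subst₂ ℤ._<_ (∑-word i n l) (sym Tx)
                      (∑val-< (sorted i cl) peak lt)
          ; right = λ {n} _ _ → subst₂ ℤ._≤_ (∑-word i n l) (sym Tx)
                      (∑val-≤ (sorted i cl) below n) }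
        ; extreme = λ y add same → locate y same
            (∈-++⁻ u (subst (plus y ∈ˡ_) (sym eq)
              (∈-word {i} {l} {plus y} (trans (cong color same) onto , add))))
        }
        where
        onto : color (lad x) ≡ i
        onto = proj₁ (word-marked {i} {l} {plus x} (subst (plus x ∈ˡ_) eq (∈-insert u)))
        Tx : T i (lad x) l ≡ + suc k
        Tx = trans (sym (∑-word i (lad x) l)) (∑val-peak (sorted i cl) below peak)
        locate : ∀ y → lad y ≡ lad x → plus y ∈ˡ u ⊎ plus y ∈ˡ plus x ∷ v → proj₁ y ⊑ proj₁ x
        locate y same (inj₁ y∈u) = All.lookup (proj₁ (AllPairs-middle u
          (subst (AllPairs _) (sym eq) (by-rows i cl)))) y∈u same
        locate y same (inj₂ (here refl)) = ⊑-refl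
        locate y same (inj₂ (there y∈v)) =
          ⊥-elim (ℕ.<⇒≢ (peak-last (sorted i cl) below peak y∈v) (sym same))

    f-just : ∀ {i l m} → Class l → f i l ≡ just m → ∃ λ x → Good i l x m
    f-just {i} {l} {m} cl eq with rightmostPlus (word i l) in last≡
    ... | just s with k , x , refl , below , peak ← rightmostPlus-just (word i l) last≡
      with addable? l x
    f-just cl refl | just s | yes (m , add) = x , good cl (IsAdd⇒Grow add) below peak

    f-nothing : ∀ {i l} → Class l → f i l ≡ nothing → ∀ n → T i n l ℤ.≤ 0ℤ
    f-nothing {i} {l} cl eq n with rightmostPlus (word i l) in last≡
    ... | nothing = subst (ℤ._≤ 0ℤ) (∑-word i n l)
                      (∑val-≤ (sorted i cl) (rightmostPlus-nothing (word i l) last≡) n)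
    ... | just s with k , x , refl , below , u , v , split , _ ← rightmostPlus-just (word i l) last≡
      with addable? l x
    f-nothing {i} {l} cl () n | just s | yes (m , add)
    -- The chosen letter comes from the marks, so adding its box cannot fail.
    ... | no ¬add = ⊥-elim (¬add (criterion⇒addable l x
                      (proj₂ (word-marked {i} {l} {plus x} (subst (plus x ∈ˡ_) split (∈-insert u))))))

    f-class : ∀ {i l m} → Class l → f i l ≡ just m → Class m
    f-class {i} {l} cl eq with f-just cl eq
    ... | x , G = class-grow cl grow extreme
      (remove-if-add onto l (right (trans (color-+ℓ (lad x)) onto) (ℕ.m<m+n (lad x) ℕ.z<s)))
      where
      open Good G
      open FirstMax first

    generated-class : ∀ {m} → Generated f m → Class m
    generated-class start         = class-∅
    generated-class (next i g eq) = f-class (generated-class g) eq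

    f-defined : ∀ {i n l} → Class l → FirstMax i n l → ∃ λ m → ∃ λ x →
                f i l ≡ just m × Good i l x m × lad x ≡ n
    f-defined {i} {n} {l} cl F with f i l in eq
    ... | nothing = ⊥-elim (ℤ.<⇒≱ (FirstMax.pos F) (f-nothing cl eq n))
    ... | just m with x , G ← f-just cl eq =
      m , x , refl , G , FirstMax-unique {l = l} (λ _ → refl) (Good.first G) F

    -- The drop of T behind its last maximum forces a - on ladder n. The first such - in the word is
    -- removed, being the one that `class-shrink` asks for.
    shrink : ∀ {i n m} → Class m → LastMax i n m →
             ∃₂ λ l x → Grow l x m × lad x ≡ n × Class l
    shrink {i} {n} {m} cm L
      with y , rem , refl ← remove-if-drop (LastMax.onto L) m
             (LastMax.right L (trans (color-+ℓ n) (LastMax.onto L)) (ℕ.m<m+n n ℕ.z<s))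
      with u , minus x , v , eq , (refl , same) , none ← first-any
             (λ s → (proj₁ s Sign.≟ Sign.-) ×-dec (lad (proj₂ s) ≟ lad y))
             (lose (∈-word {i} {m} {minus y} (LastMax.onto L , rem)) (refl , refl))
      = l , x , g , same , class-shrink cm g
          (λ z rem-z same-z → locate z (trans same-z same) (∈-++⁻ u (subst (minus z ∈ˡ_) (sym eq)
            (∈-word {i} {m} {minus z} (trans (cong color (trans same-z same)) onto , rem-z)))))
          λ {k} k≡ has → subst (HasAdd m) k≡
            (add-if-remove (k≡i k≡) m
              (subst (λ t → T i k m ℤ.≤ T i t m) (sym (trans k≡ same))
                (left (k≡i k≡) (ℕ.<-≤-trans (ℕ.m<m+n k ℕ.z<s) (ℕ.≤-reflexive (trans k≡ same))))) has)
      where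
      open LastMax L
      removable : Removable m x
      removable = criterion⇒removable m x
        (proj₂ (word-marked {i} {m} {minus x} (subst (minus x ∈ˡ_) eq (∈-insert u))))
      l = proj₁ removable
      g = IsRemove⇒Grow (proj₂ removable)
      k≡i : ∀ {k} → k + ℓ ≡ lad x → color k ≡ i
      k≡i {k} k≡ = trans (sym (color-+ℓ k)) (trans (cong color (trans k≡ same)) onto)
      locate : ∀ z → lad z ≡ lad y → minus z ∈ˡ u ⊎ minus z ∈ˡ minus x ∷ v →
               proj₁ x ⊑ proj₁ z
      locate z same-z (inj₁ z∈u)           = ⊥-elim (All.lookup none z∈u (refl , same-z))
      locate z same-z (inj₂ (here refl))   = ⊑-refl
      locate z same-z (inj₂ (there z∈v)) = All.lookup (proj₂ (AllPairs-middle u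
        (subst (AllPairs _) (sym eq) (by-rows i cm)))) z∈v (trans same (sym same-z))

    private
      same-growth : ∀ {l m l′ m′ x y} → Grow l x l′ → Grow m y m′ → l ≡ m → x ≡ y → l′ ≡ m′
      same-growth g h refl refl = Grow-functional g h

    -- Induction on the generation of m. The ladder of its last box is a last maximum for m, hence
    -- also for l. A box of that ladder is removed from both, and `class-unique` identifies the two
    -- boxes.
    ∼-injective : ∀ {l m} → Class l → Generated f m → l ∼ m → l ≡ m
    ∼-injective {l} cl start eq = size-zero l (ℤ.≤-reflexive (eq λ _ → 1ℤ))
    ∼-injective {l} cl (next i {m} gm fm≡) eq =
      let cm = generated-class gm
          x , G = f-just cm fm≡
          h = Good.grow G
          l′ , y , g , same , cl′ = shrink cl
            (LastMax-cong (λ H → sym (eq H)) (FirstMax⇒LastMax h (Good.first G)))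
          l′≡m = ∼-injective cl′ gm (∼-shrink g h same eq)
      in same-growth g h l′≡m
           (class-unique (subst (λ k → Grow k y l) l′≡m g) h cl (f-class cm fm≡) same)

    private
      -- Removal at a last maximum leaves a first maximum on the same ladder, so f returns to that
      -- ladder, and `class-unique` makes it add the same box.
      restore : ∀ {i l x m} → Grow l x m → Class l → Class m → LastMax i (lad x) m →
                f i l ≡ just m
      restore {i} {l} {x} {m} g cl cm L =
        let m′ , y , fl≡ , G , same = f-defined cl (LastMax⇒FirstMax g L)
        in trans fl≡ (cong just (same-growth (Good.grow G) g refl
             (class-unique (Good.grow G) g (f-class cl fl≡) cm same)))

      size-pred : ∀ {l x m k} → Grow l x m → size m ℤ.≤ + suc k → size l ℤ.≤ + k
      size-pred {l} {x} {m} g le = subst₂ ℤ._≤_ (pred (size l)) refl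
        (ℤ.+-monoʳ-≤ -1ℤ (subst (ℤ._≤ _) (boxsum-grow g λ _ → 1ℤ) le))
        where
        pred : ∀ t → -1ℤ ℤ.+ (t ℤ.+ 1ℤ) ≡ t
        pred = ℤ-Solver.solve-∀

      predecessor : ∀ {m} → Class m → (∃₂ λ i n → LastMax i n m) →
                    ∃₂ λ i l → ∃ λ x → Grow l x m × Class l × f i l ≡ just m
      predecessor {m} cm (i , n , L) with shrink cm L
      ... | l , x , g , refl , cl = i , l , x , g , cl , restore g cl cm L

    -- The premise ensures that boxes can be removed until ∅ is reached; the recursion is bounded by
    -- their number.
    generate : (∀ {m} → Class m → 0 < row m 0 → ∃₂ λ i n → LastMax i n m) →
               ∀ {m} → Class m → Generated f m
    generate exists {m} cm = go ℤ.∣ size m ∣ m cm (ℤ.≤-reflexive (sym (ℤ.0≤i⇒+∣i∣≡i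
      (∑<-nonneg (length (parts m)) λ a → ∑<-nonneg (row m a) λ _ → ℤ.+≤+ z≤n))))
      where
      go : ∀ k m → Class m → size m ℤ.≤ + k → Generated f m
      by-row₀ : ∀ k m → Class m → size m ℤ.≤ + suc k → ∀ r → row m 0 ≡ r → Generated f m
      go zero    m cm le = subst (Generated f) (sym (size-zero m le)) start
      go (suc k) m cm le = by-row₀ k m cm le (row m 0) refl
      by-row₀ k m cm le zero    eq = subst (Generated f) (sym (row₀-zero m eq)) start
      by-row₀ k m cm le (suc _) eq
        with i , l , x , g , cl , fl≡ ← predecessor cm (exists cm (subst (0 <_) (sym eq) ℕ.z<s))
        = next i (go k l cl (size-pred g le)) fl≡

  -- Passing from one crystal to the other

  module Transfer (M N : Model) where
    private
      module M = Model M
      module N = Model N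

    -- Equivalent partitions have the same T, so both operators add to the same ladder, and the
    -- second cannot be 0 where T is positive.
    f-transfer : ∀ {i l m l′} → M.Class l → N.Class m → l ∼ m → M.f i l ≡ just l′ →
                 ∃ λ m′ → N.f i m ≡ just m′ × l′ ∼ m′
    f-transfer {i} {l} {m} cl cm eq fm≡ with x , G ← M.f-just cl fm≡
      with N.f i m in fm≡′
    ... | nothing = ⊥-elim (ℤ.<⇒≱ (FirstMax.pos first)
            (subst (ℤ._≤ 0ℤ) (sym (T-cong i (lad x) onto eq)) (N.f-nothing cm fm≡′ (lad x))))
      where
      open M.Good G
      open FirstMax first
    ... | just m′ with y , G′ ← N.f-just cm fm≡′ = m′ , refl ,
      ∼-grow (M.Good.grow G) (N.Good.grow G′)
        (FirstMax-unique eq (M.Good.first G) (N.Good.first G′)) eq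

    generated-transfer : ∀ {l} → Generated M.f l → ∃ λ m → Generated N.f m × l ∼ m
    generated-transfer start = ∅ , start , λ _ → refl
    generated-transfer (next i gl fm≡) with m , gm , eq ← generated-transfer gl
      with m′ , fm≡′ , eq′ ← f-transfer (M.generated-class gl) (N.generated-class gm) eq fm≡
      = m′ , next i gm fm≡′ , eq′

  -- Partitions without forbidden hooks

  lad-left : ∀ {a b a′ b′} → lad (a , suc b) ≡ lad (a′ , suc b′) → lad (a , b) ≡ lad (a′ , b′)
  lad-left {a} {b} {a′} {b′} eq = ℕ.+-cancelʳ-≡ e _ _
    (trans (sym (lad-right a b)) (trans eq (lad-right a′ b′)))

  -- No hook whose hand (a , b) lies on the same ladder as the position (suc c , t)
  -- just below its foot, that is, no hook of ℓ times its arm length.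
  HookFree : Partition → Set
  HookFree μ = ∀ {a b c t} → row μ a ≡ suc b → a ≤ c → row μ (suc c) ≤ t → t < row μ c →
               lad (a , b) ≢ lad (suc c , t)

  -- If y is in a lower row, the box above y is the foot of its column, and a common ladder would
  -- give a forbidden hook with hand x. In a common row, x and y would coincide, although only x is
  -- a box.
  hookFree-separates : ∀ {μ x y} → HookFree μ → RemoveCriterion μ x → AddCriterion μ y →
                       proj₁ x ≤ proj₁ y → lad x ≢ lad y
  hookFree-separates {μ} {a , b} {c , t} free (hand , _) (foot , above) le same
    with ℕ.m≤n⇒m<n∨m≡n le
  ... | inj₂ refl = ℕ.1+n≢n (trans hand (trans (sym foot) (sym (lad-same-row {a} same))))
  hookFree-separates {μ} {a , b} {suc c , t} free (hand , _) (foot , above) le same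
      | inj₁ (s≤s a≤c) =
    free (sym hand) a≤c (ℕ.≤-reflexive (sym foot)) (above c refl) same

  hookFree-∅ : HookFree ∅
  hookFree-∅ ()

  module _ {l m : Partition} {p q : ℕ} (g : Grow l (p , q) m) where
    open Grow g

    private
      addable-x : AddCriterion l (p , q)
      addable-x = addCriterion

      removable-x : RemoveCriterion m (p , q)
      removable-x = removeCriterion

    -- A forbidden hook of m is one of l already unless x is its hand or its foot; these two cases
    -- are refuted by `new-hand` and `new-foot`.
    hookFree-grow : HookFree l →
      (∀ y → AddCriterion l y → lad y ≡ lad (p , q) → proj₁ y ≤ p) →
      (HasAdd l (lad (p , q) + ℓ) → HasRemove l (lad (p , q))) → HookFree m
    hookFree-grow free lowest balance {a} {b} {c} {t} hand a≤c under over same =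
      by-foot foot
      where
      under-l : row l (suc c) ≤ t
      under-l = ℕ.≤-trans (Grow-≤ g (suc c)) under

      foot : t < row l c ⊎ c ≡ p × t ≡ q
      foot with c ≟ p
      ... | no ne = inj₁ (ℕ.<-≤-trans over (ℕ.≤-reflexive (other c ne)))
      ... | yes refl with ℕ.m≤n⇒m<n∨m≡n (ℕ.≤-pred (ℕ.<-≤-trans over (ℕ.≤-reflexive at-new)))
      ...   | inj₁ t<q = inj₁ (ℕ.<-≤-trans t<q (ℕ.≤-reflexive (sym at-old)))
      ...   | inj₂ t≡q = inj₂ (refl , t≡q)

      -- Either the position below the foot is addable, which contradicts the choice of x as the
      -- lowest on its ladder, or the hand and the foot column can both move one column to the left,
      -- giving a forbidden hook of l.
      new-hand : a ≡ p → t < row l c → ⊥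
      new-hand refl over-l with ℕ.m≤n⇒m<n∨m≡n under-l
                              | ℕ.suc-injective (trans (sym hand) at-new)
      ... | inj₂ at-foot | refl = ℕ.<⇒≱ (s≤s a≤c) (lowest (suc c , t)
              (sym at-foot , λ { _ refl → over-l }) (sym same))
      ... | inj₁ (s≤s {n = t′} under′) | refl = shift q at-old same
        where
        shift : ∀ b → row l p ≡ b → lad (p , b) ≡ lad (suc c , suc t′) → ⊥
        shift zero    _    same = ℕ.<⇒≢ (lad-mono-<ˡ {a = p} (s≤s a≤c) z≤n) same
        shift (suc b) hand same = free hand a≤c under′ (ℕ.<-trans ℕ.≤-refl over-l)
          (lad-left {p} {b} {suc c} {t′} same)

      -- The position right of the hand is addable: otherwise the hand one row higher and the foot
      -- above x would be forbidden in l. It lies ℓ ladders after x, so `balance` yields a removable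
      -- box on the ladder of x.
      new-foot : ∀ {a b} → row l a ≡ suc b → a < p → lad (a , b) ≡ suc (lad (p , q)) → ⊥
      new-foot {a} {b} hand-l a<p same-l = contradict
        (balance ((a , suc b) , (sym hand-l , above a hand-l a<p same-l) ,
          trans (lad-right a b) (trans (cong (_+ e) same-l) (sym (ℕ.+-suc _ e)))))
        where
        above : ∀ a → row l a ≡ suc b → a < p → lad (a , b) ≡ suc (lad (p , q)) →
                ∀ c → a ≡ suc c → suc b < row l c
        above _ hand-l a<p same-l c refl
          with ℕ.m≤n⇒m<n∨m≡n (ℕ.≤-trans (ℕ.≤-reflexive (sym hand-l)) (row-antitone l c))
        ... | inj₁ lt = lt
        ... | inj₂ eq = ⊥-elim (hand-above p a<p refl)
          where
          hand-above : ∀ p′ → suc c < p′ → p ≡ p′ → ⊥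
          hand-above (suc p″) (s≤s c<p″) refl =
            free (sym eq) (ℕ.<⇒≤ c<p″) (ℕ.≤-reflexive at-old) (proj₂ addable-x p″ refl)
              (ℕ.suc-injective same-l)
        -- If that box is above x, it is separated from x; if not, it is the foot of a forbidden
        -- hook with the old hand.
        contradict : HasRemove l (lad (p , q)) → ⊥
        contradict ((r , s) , rem-l , same-r) with p ≤? r
        ... | no p≰r  = hookFree-separates {l} free rem-l addable-x (ℕ.<⇒≤ (ℕ.≰⇒> p≰r)) same-r
        ... | yes p≤r = free hand-l (ℕ.≤-trans (ℕ.<⇒≤ a<p) p≤r) (proj₂ rem-l)
                          (ℕ.≤-reflexive (proj₁ rem-l))
                          (trans same-l (cong suc (sym same-r)))

      by-foot : t < row l c ⊎ c ≡ p × t ≡ q → ⊥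
      by-foot f with a ≟ p
      by-foot (inj₁ over-l)        | yes a≡p  = new-hand a≡p over-l
      by-foot (inj₂ (refl , refl)) | yes refl
        with refl ← ℕ.suc-injective (trans (sym hand) at-new) = ℕ.1+n≢n (sym same)
      by-foot (inj₁ over-l)        | no a≢p   =
        free (trans (sym (other a a≢p)) hand) a≤c under-l over-l same
      by-foot (inj₂ (refl , refl)) | no a≢p   =
        new-foot (trans (sym (other a a≢p)) hand) (ℕ.≤∧≢⇒< a≤c a≢p) same

    hookFree-shrink : HookFree m →
      (∀ y → RemoveCriterion m y → lad y ≡ lad (p , q) → p ≤ proj₁ y) →
      (∀ {n} → n + ℓ ≡ lad (p , q) → HasRemove m n → HasAdd m (lad (p , q))) → HookFree l
    hookFree-shrink free highest balance {a} {b} {c} {t} hand a≤c under over same =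
      by-foot foot
      where
      over-m : t < row m c
      over-m = ℕ.<-≤-trans over (Grow-≤ g c)

      foot : row m (suc c) ≤ t ⊎ suc c ≡ p × t ≡ q
      foot with suc c ≟ p
      ... | no ne = inj₁ (ℕ.≤-trans (ℕ.≤-reflexive (other (suc c) ne)) under)
      ... | yes refl with ℕ.m≤n⇒m<n∨m≡n (ℕ.≤-trans (ℕ.≤-reflexive (sym at-old)) under)
      ...   | inj₁ q<t = inj₁ (ℕ.≤-trans (ℕ.≤-reflexive at-new) q<t)
      ...   | inj₂ q≡t = inj₂ (refl , sym q≡t)

      -- The hand and the foot column both move one column to the right, unless (c , t) is
      -- removable. In that case it lies ℓ ladders before x, and `balance` yields an addable
      -- position on the ladder of x.
      new-hand : a ≡ p → q ≡ suc b → row m (suc c) ≤ t → ⊥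
      new-hand refl refl under-m with ℕ.m≤n⇒m<n∨m≡n over-m
      ... | inj₁ lt = free at-new a≤c (ℕ.m≤n⇒m≤1+n under-m) lt
              (trans (lad-right a b) (trans (cong (_+ e) same) (sym (lad-right (suc c) t))))
      ... | inj₂ eq = contradict (balance {lad (c , t)}
              (trans (ℕ.+-suc _ e) (trans (cong (_+ e) (sym same)) (sym (lad-right a b))))
              ((c , t) , (eq , under-m) , refl))
        where
        contradict : HasAdd m (lad (a , suc b)) → ⊥
        contradict ((r , s) , add-m , same-r) with p ≤? r
        ... | yes p≤r = hookFree-separates {m} free removable-x add-m p≤r (sym same-r)
        ... | no p≰r with s
        ...   | zero   = ℕ.<⇒≢ (lad-mono-<ˡ {b = 0} {b′ = suc b} (ℕ.≰⇒> p≰r) z≤n) same-r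
        -- The box left of this higher addable position is a hand on the ladder of (a , b),
        -- forbidden with the same foot.
        ...   | suc s′ = free (sym (proj₁ add-m))
                 (ℕ.≤-trans (ℕ.<⇒≤ (ℕ.≰⇒> p≰r)) a≤c) under-m over-m
                 (trans (lad-left {r} {s′} {a} {b} same-r) same)

      -- A removable hand would be a - above x on its ladder. Otherwise the hand one row lower forms
      -- a forbidden hook of m with foot x.
      new-foot : p ≡ suc c → row m a ≡ suc b → lad (a , b) ≡ lad (p , q) → ⊥
      new-foot refl hand-m same-m with row m (suc a) ≤? b
      ... | yes le = ℕ.<⇒≱ (s≤s a≤c) (highest (a , b) (sym hand-m , le) same-m)
      ... | no ≰   = free
              (ℕ.≤-antisym (ℕ.≤-trans (row-antitone m a) (ℕ.≤-reflexive hand-m)) (ℕ.≰⇒> ≰))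
              (s≤s a≤c) (proj₂ removable-x) (ℕ.≤-reflexive (proj₁ removable-x)) (cong suc same-m)

      by-foot : row m (suc c) ≤ t ⊎ suc c ≡ p × t ≡ q → ⊥
      by-foot f with a ≟ p
      by-foot (inj₁ under-m)       | yes a≡p = new-hand a≡p
        (trans (sym at-old) (trans (cong (row l) (sym a≡p)) hand)) under-m
      by-foot (inj₂ (refl , refl)) | yes refl = ℕ.<⇒≱ a≤c ℕ.≤-refl
      by-foot (inj₁ under-m)       | no a≢p =
        free (trans (other a a≢p) hand) a≤c under-m over-m same
      by-foot (inj₂ (refl , refl)) | no a≢p =
        new-foot refl (trans (other a a≢p) hand) same

  same-position : ∀ {x y : Position} → ¬ proj₁ x < proj₁ y → ¬ proj₁ y < proj₁ x →
                  lad x ≡ lad y → x ≡ y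
  same-position {a , b} {a′ , b′} ≮ ≯ same with refl ← ℕ.≤-antisym (ℕ.≮⇒≥ ≯) (ℕ.≮⇒≥ ≮) =
    cong (a ,_) (lad-same-row {a} same)

  -- Of two addable positions on a ladder, the upper one, once added, is the hand of a forbidden
  -- hook whose foot is just above the lower one.
  hookFree-unique : ∀ {l x m y n} → Grow l x m → Grow l y n → HookFree m → HookFree n →
                    lad x ≡ lad y → x ≡ y
  hookFree-unique {l} g h free-m free-n same = same-position
    (λ lt → ordered g h free-m lt same) (λ lt → ordered h g free-n lt (sym same)) same
    where
    ordered : ∀ {x m y n} → Grow l x m → Grow l y n → HookFree m → proj₁ x < proj₁ y →
              lad x ≢ lad y
    ordered {a , b} {m} {suc c , t} g h free lt = free (Grow.at-new g) (ℕ.≤-pred lt)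
      (ℕ.≤-reflexive (trans (Grow.other g (suc c) (ℕ.<⇒≢ lt ∘ sym)) (Grow.at-old h)))
      (ℕ.<-≤-trans (proj₂ (Grow.addCriterion h) c refl) (Grow-≤ g c))

  -- Regular partitions

  -- Equal parts are consecutive, so excluding ℓ of them amounts to comparing rows that are ℓ - 1
  -- apart.
  Reg : Partition → Set
  Reg μ = ∀ a → 0 < row μ (a + e) → row μ (a + e) < row μ a

  reg-∅ : Reg ∅
  reg-∅ a ()

  module _ {μ : Partition} (reg : Reg μ) where

    private
      climb : ∀ k {a b} → b < row μ (a + k * e) → b + k < row μ a
      climb zero {a} {b} lt rewrite ℕ.+-identityʳ a | ℕ.+-identityʳ b = lt
      climb (suc k) {a} {b} lt = subst (_< row μ a) (sym (ℕ.+-suc b k)) (climb k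
        (ℕ.≤-<-trans lt′ (reg (a + k * e) (ℕ.≤-<-trans z≤n lt′))))
        where
        lt′ : b < row μ (a + k * e + e)
        lt′ = subst (λ t → b < row μ t) (shuffle a k d) lt
          where
          shuffle : ∀ a k d → a + suc k * suc d ≡ a + k * suc d + suc d
          shuffle = ℕ-Solver.solve-∀

    -- Every e rows upwards the rim gains at least one column, which is the slope of a ladder.
    -- Strictness comes from rounding the row difference up to one more full step.
    reg-lad : ∀ {a b c t} → b < row μ a → row μ c ≤ t → c ≤ a → lad (a , b) < lad (c , t)
    reg-lad {a} {b} {c} {t} inside outside c≤a with ℕ.m≤n⇒∃[o]m+o≡n c≤a
    ... | o , refl = begin-strict
      c + o + e * b              ≡⟨ cong (λ t → c + t + e * b) (m≡m%n+[m/n]*n o e) ⟩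
      c + (o % e + q * e) + e * b <⟨ ℕ.+-monoˡ-< (e * b)
                                     (ℕ.+-monoʳ-< c (ℕ.+-monoˡ-< (q * e) (m%n<n o e))) ⟩
      c + (e + q * e) + e * b     ≡⟨ shuffle c q b d ⟩
      c + e * suc (b + q)         ≤⟨ ℕ.+-monoʳ-≤ c (ℕ.*-monoʳ-≤ e (ℕ.<-≤-trans climbed outside)) ⟩
      c + e * t                   ∎
      where
      open ℕ.≤-Reasoning
      q = o / e
      shuffle : ∀ c q b d → c + (suc d + q * suc d) + suc d * b ≡ c + suc d * suc (b + q)
      shuffle = ℕ-Solver.solve-∀
      climbed : b + q < row μ c
      climbed = climb q (ℕ.<-≤-trans inside (row-≤ μ (ℕ.+-monoʳ-≤ c
        (ℕ.≤-trans (ℕ.m≤n+m (q * e) (o % e)) (ℕ.≤-reflexive (sym (m≡m%n+[m/n]*n o e)))))))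

  module _ {l m : Partition} {p q : ℕ} (g : Grow l (p , q) m) where
    open Grow g

    -- Regularity can only fail if x ends the last of ℓ equal rows. The position behind the first of
    -- them is then addable, on the ladder of x and higher up.
    reg-grow : Reg l → (∀ y → AddCriterion l y → lad y ≡ lad (p , q) → p ≤ proj₁ y) → Reg m
    reg-grow reg highest a pos with a + e ≟ p
    ... | no ne = ℕ.≤-<-trans (ℕ.≤-reflexive (other _ ne))
      (ℕ.<-≤-trans (reg a (ℕ.<-≤-trans pos (ℕ.≤-reflexive (other _ ne)))) (Grow-≤ g a))
    ... | yes refl = ℕ.≤-<-trans (ℕ.≤-reflexive at-new)
      (ℕ.<-≤-trans (ℕ.≤∧≢⇒< wide not-equal) (Grow-≤ g a))
      where
      q<above : q < row l (a + d)
      q<above = proj₂ addCriterion (a + d) (ℕ.+-suc a d)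
      wide : suc q ≤ row l a
      wide = ℕ.≤-trans q<above (row-≤ l (ℕ.m≤m+n a d))
      not-equal : suc q ≢ row l a
      not-equal eq = ℕ.<⇒≱ (ℕ.m<m+n a ℕ.z<s) (highest (a , suc q)
        (eq , λ { c refl →
          let q<row : q < row l (c + e)
              q<row = subst (λ t → q < row l t) (sym (ℕ.+-suc c d)) q<above
          in ℕ.≤-<-trans q<row (reg c (ℕ.≤-<-trans z≤n q<row)) })
        (trans (lad-right a q) (swap a q d)))
        where
        swap : ∀ a q d → a + suc d * q + suc d ≡ a + suc d + suc d * q
        swap = ℕ-Solver.solve-∀

    -- Regularity can only fail if the row of x becomes the first of ℓ equal rows. The last of them
    -- then ends in a removable box of m, on the ladder of x and lower down.
    reg-shrink : Reg m → (∀ y → RemoveCriterion m y → lad y ≡ lad (p , q) → proj₁ y ≤ p) → Reg l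
    reg-shrink reg lowest a pos with a ≟ p
    ... | no ne = ℕ.≤-<-trans (Grow-≤ g (a + e))
      (ℕ.<-≤-trans (reg a (ℕ.<-≤-trans pos (Grow-≤ g (a + e)))) (ℕ.≤-reflexive (other a ne)))
    ... | yes refl = ℕ.<-≤-trans (ℕ.≤∧≢⇒< narrow not-equal) (ℕ.≤-reflexive (sym at-old))
      where
      far : row m (a + e) ≡ row l (a + e)
      far = other (a + e) (ℕ.<⇒≢ (ℕ.m<m+n a ℕ.z<s) ∘ sym)
      next≤q : row m (suc a) ≤ q
      next≤q = proj₂ removeCriterion
      narrow : row l (a + e) ≤ q
      narrow = ℕ.≤-trans (ℕ.≤-reflexive (sym far)) (ℕ.≤-trans
        (row-≤ m (ℕ.≤-trans (s≤s (ℕ.m≤m+n a d)) (ℕ.≤-reflexive (sym (ℕ.+-suc a d))))) next≤q)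
      not-equal : row l (a + e) ≢ q
      not-equal eq with q′ , refl ← pos⇒suc (subst (0 <_) eq pos) =
        ℕ.<⇒≱ (ℕ.m<m+n a ℕ.z<s) (lowest (a + e , q′)
          (sym (trans far eq) , under (row m (suc a + e)) refl) (shuffle a q′ d))
        where
        shuffle : ∀ a q d → a + suc d + suc d * q ≡ a + suc d * suc q
        shuffle = ℕ-Solver.solve-∀
        under : ∀ r → row m (suc a + e) ≡ r → r ≤ q′
        under zero    _  = z≤n
        under (suc r) r≡ = ℕ.≤-pred (ℕ.≤-trans
          (subst (_< row m (suc a)) r≡ (reg (suc a) (subst (0 <_) (sym r≡) ℕ.z<s))) next≤q)

  -- If the lower of two addable positions on a ladder is added, `reg-lad` puts it on a strictly
  -- earlier ladder than the upper one.
  reg-unique : ∀ {l x m y n} → Grow l x m → Grow l y n → Reg m → Reg n → lad x ≡ lad y → x ≡ y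
  reg-unique {l} g h reg-m reg-n same = same-position
    (λ lt → ordered g h reg-n lt (sym same)) (λ lt → ordered h g reg-m lt same) same
    where
    ordered : ∀ {x m y n} → Grow l x m → Grow l y n → Reg n → proj₁ x < proj₁ y → lad y ≢ lad x
    ordered {a , b} {m} {c , t} {n} g h reg lt = ℕ.<⇒≢ (reg-lad {n} reg
      (ℕ.≤-reflexive (sym (Grow.at-new h)))
      (ℕ.≤-reflexive (trans (Grow.other h a (ℕ.<⇒≢ lt)) (Grow.at-old g))) (ℕ.<⇒≤ lt))

  -- The order of the marks in both signatures

  cells-rows : ∀ μ → AllPairs (λ x y → proj₁ x ≤ proj₁ y) (cells μ)
  cells-rows μ = AllPairs-concatMap _ (suc (length (parts μ)))
    (λ a → AllPairs.map⁺ (AllPairs.applyUpTo⁺₁ id (suc (row μ a)) λ _ _ → ℕ.≤-refl))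
    (λ i<j → All.map⁺ (All.tabulate λ _ → All.map⁺ (All.tabulate λ _ → ℕ.<⇒≤ i<j)))

  marks-rows : ∀ i μ → AllPairs (λ s t → proj₁ (proj₂ s) ≤ proj₁ (proj₂ t)) (marks ℓ i μ)
  marks-rows i μ = AllPairs-mapMaybe (mark ℓ i μ)
    (λ {x} {y} fx fy le → subst₂ _≤_ (cong proj₁ (sym (proj₂ (mark-marked i μ x fx))))
      (cong proj₁ (sym (proj₂ (mark-marked i μ y fy)))) le)
    (cells-rows μ)

  private
    Ordered : Sign × Position → Sign × Position → Set
    Ordered s t = Before s t ×
      (lad (proj₂ s) ≡ lad (proj₂ t) → proj₁ (proj₂ s) ≤ proj₁ (proj₂ t))

  module _ (i : Fin ℓ) {μ : Partition} where

    private
      w = marks ℓ i μ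
      bound = suc (max 0 (map (λ s → ladder ℓ (proj₂ s)) w))

    ladderSignature-↭ : ladderSignature ℓ i μ ↭ marks ℓ i μ
    ladderSignature-↭ = concatMap-filter-↭ (λ s → ladder ℓ (proj₂ s)) bound
      (All.map s≤s (All.map⁻ (xs≤max 0 (map (λ s → ladder ℓ (proj₂ s)) w))))

    -- Filtering keeps the marks of a ladder in the order of their rows, and `hookFree-separates`
    -- excludes a - above a + there.
    ladderSignature-ordered : HookFree μ → AllPairs Ordered (ladderSignature ℓ i μ)
    ladderSignature-ordered free = AllPairs-concatMap level bound inner outer
      where
      level : ℕ → Word
      level k = filter (λ s → ladder ℓ (proj₂ s) ≟ k) w
      on-level : ∀ k → All (λ s → Marked i μ s × ladder ℓ (proj₂ s) ≡ k) (level k)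
      on-level k = All.zipWith id
        (All.filter⁺ (λ s → ladder ℓ (proj₂ s) ≟ k) (marks-marked i μ) ,
         All.all-filter (λ s → ladder ℓ (proj₂ s) ≟ k) w)
      no-minus-plus : ∀ s t → Marked i μ s → Marked i μ t → proj₁ (proj₂ s) ≤ proj₁ (proj₂ t) →
        lad (proj₂ s) ≡ lad (proj₂ t) → proj₁ s ≡ Sign.- → proj₁ t ≡ Sign.+ → ⊥
      no-minus-plus (minus x) (plus y) (_ , rem-x) (_ , add-y) le same refl refl =
        hookFree-separates {μ} free rem-x add-y le same
      inner : ∀ k → AllPairs Ordered (level k)
      inner k = AllPairs.map
        (λ { {s} {t} ((ms , ks) , (mt , kt) , le) →
          (ℕ.≤-reflexive (ℕ.suc-injective (trans ks (sym kt))) ,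
           no-minus-plus s t ms mt le) , λ _ → le })
        (AllPairs-with (on-level k)
          (AllPairs.filter⁺ (λ s → ladder ℓ (proj₂ s) ≟ k) (marks-rows i μ)))
      outer : ∀ {j k} → j < k → All (λ s → All (Ordered s) (level k)) (level j)
      outer {j} {k} j<k = All.map (λ { {s} (_ , ks) → All.map (λ { {t} (_ , kt) →
        let lt : lad (proj₂ s) < lad (proj₂ t)
            lt = ℕ.≤-pred (subst₂ _<_ (sym ks) (sym kt) j<k)
        in (ℕ.<⇒≤ lt , λ same → ⊥-elim (ℕ.<⇒≢ lt same)) , λ same → ⊥-elim (ℕ.<⇒≢ lt same) })
        (on-level k) }) (on-level j)

    -- A marked position may be inside or outside, but the position above it is a box and the one
    -- below it is not. These neighbours are what `reg-lad` is applied to.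
    marked-inside : ∀ s {a b} → Marked i μ s → proj₂ s ≡ (suc a , b) → b < row μ a
    marked-inside (plus _)  (_ , _ , above)   refl = above _ refl
    marked-inside (minus _) (_ , hand , _) refl =
      ℕ.≤-trans (ℕ.≤-reflexive hand) (row-antitone μ _)

    marked-≤ : ∀ s → Marked i μ s → proj₂ (proj₂ s) ≤ row μ (proj₁ (proj₂ s))
    marked-≤ (plus _)  (_ , eq , _)   = ℕ.≤-reflexive eq
    marked-≤ (minus _) (_ , hand , _) = ℕ.<⇒≤ (ℕ.≤-reflexive hand)

    marked-≥ : ∀ s → Marked i μ s → row μ (proj₁ (proj₂ s)) ≤ suc (proj₂ (proj₂ s))
    marked-≥ (plus _)  (_ , eq , _)   = ℕ.m≤n⇒m≤1+n (ℕ.≤-reflexive (sym eq))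
    marked-≥ (minus _) (_ , hand , _) = ℕ.≤-reflexive (sym hand)

    marked-outside : ∀ s → Marked i μ s → row μ (suc (proj₁ (proj₂ s))) ≤ proj₂ (proj₂ s)
    marked-outside (plus _)  (_ , eq , _)    =
      ℕ.≤-trans (row-antitone μ _) (ℕ.≤-reflexive (sym eq))
    marked-outside (minus _) (_ , _ , under) = under

    marked-color : ∀ s → Marked i μ s → color (lad (proj₂ s)) ≡ i
    marked-color (plus _)  (c , _) = c
    marked-color (minus _) (c , _) = c

    -- Both residues agree, so it suffices that s is less than ℓ ladders beyond t. This leaves room
    -- for the detour through the box above s and the position below t.
    reg-upwards : Reg μ → ∀ s t → Marked i μ s → Marked i μ t →
                  proj₁ (proj₂ t) ≤ proj₁ (proj₂ s) → lad (proj₂ s) ≤ lad (proj₂ t)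
    reg-upwards reg s t ms mt le = ℕ.≮⇒≥ λ lt → ℕ.<⇒≱ (close (proj₂ s) refl le)
      (color-gap (trans (marked-color t mt) (sym (marked-color s ms))) lt)
      where
      c = proj₁ (proj₂ t)
      u = proj₂ (proj₂ t)
      same-row : ∀ {b} → b ≤ row μ c → lad (c , b) < lad (c , u) + ℓ
      same-row {b} b≤ = ℕ.≤-<-trans (lad-mono {c} ℕ.≤-refl (ℕ.≤-trans b≤ (marked-≥ t mt)))
        (ℕ.≤-<-trans (ℕ.≤-reflexive (lad-right c u)) (ℕ.+-monoʳ-< (lad (c , u)) ℕ.≤-refl))
      near : suc (lad (c , u)) < lad (c , u) + ℓ
      near = ℕ.≤-<-trans (ℕ.≤-reflexive (ℕ.+-comm 1 (lad (c , u))))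
        (ℕ.+-monoʳ-< (lad (c , u)) (s≤s (s≤s z≤n)))
      close : ∀ x → proj₂ s ≡ x → c ≤ proj₁ x → lad x < lad (c , u) + ℓ
      close (a , b) refl c≤a with ℕ.m≤n⇒m<n∨m≡n c≤a
      ... | inj₂ refl = same-row (marked-≤ s ms)
      close (suc a , b) refl c≤a | inj₁ (s≤s c≤a′) with ℕ.m≤n⇒m<n∨m≡n c≤a′
      ... | inj₁ c<a  = ℕ.≤-<-trans
              (reg-lad {μ} reg (marked-inside s ms refl) (marked-outside t mt) c<a) near
      ... | inj₂ refl = ℕ.≤-<-trans
              (lad-mono {suc c} ℕ.≤-refl (ℕ.≤-trans (marked-≤ s ms) (marked-outside t mt))) near

    signature-ordered : Reg μ → AllPairs
      (λ s t → Before s t × (lad (proj₂ s) ≡ lad (proj₂ t) → proj₁ (proj₂ t) ≤ proj₁ (proj₂ s)))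
      (signature ℓ i μ)
    signature-ordered reg = AllPairs-reverse (AllPairs.map
      (λ { {t} {s} (mt , ms , le) →
        (reg-upwards reg s t ms mt le , no-minus-plus s t ms mt le) , λ _ → le })
      (AllPairs-with (marks-marked i μ) (marks-rows i μ)))
      where
      no-minus-plus : ∀ s t → Marked i μ s → Marked i μ t → proj₁ (proj₂ t) ≤ proj₁ (proj₂ s) →
        lad (proj₂ s) ≡ lad (proj₂ t) → proj₁ s ≡ Sign.- → proj₁ t ≡ Sign.+ → ⊥
      no-minus-plus (minus x) (plus y) (_ , hand , _) (_ , eq , _) le same refl refl =
        ℕ.<⇒≢ (reg-lad {μ} reg (ℕ.≤-reflexive hand) (ℕ.≤-reflexive (sym eq)) le) same

  -- Regularity by counting parts

  private
    count : ℕ → List ℕ → ℕ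
    count k xs = length (filter (_≟ k) xs)

    count-yes : ∀ {k} xs → count k (k ∷ xs) ≡ suc (count k xs)
    count-yes {k} xs = cong length (filter-accept (_≟ k) {xs = xs} refl)

    count-no : ∀ {x k} xs → x ≢ k → count k (x ∷ xs) ≡ count k xs
    count-no {k = k} xs ≢k = cong length (filter-reject (_≟ k) {xs = xs} ≢k)

    linked-tail : ∀ {x xs} → Linked _≥_ (x ∷ xs) → Linked _≥_ xs
    linked-tail [-]      = []
    linked-tail (_ ∷ lk) = lk

    count-run : ∀ k n a xs → 0 < k → (∀ j → j < n → nth xs (a + j) ≡ k) → n ≤ count k xs
    count-run k zero    a       xs       pos run = z≤n
    count-run k (suc n) a       []       pos run = ⊥-elim (ℕ.<⇒≢ pos (run 0 ℕ.z<s))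
    count-run k (suc n) (suc a) (x ∷ xs) pos run with x ≟ k
    ... | yes refl = ℕ.≤-trans (ℕ.m≤n⇒m≤1+n (count-run k (suc n) a xs pos run))
                       (ℕ.≤-reflexive (sym (count-yes xs)))
    ... | no ≢k    = ℕ.≤-trans (count-run k (suc n) a xs pos run)
                       (ℕ.≤-reflexive (sym (count-no xs ≢k)))
    count-run k (suc n) zero    (x ∷ xs) pos run with run 0 ℕ.z<s
    ... | refl = ℕ.≤-trans (s≤s (count-run k n 0 xs pos λ j lt → run (suc j) (s≤s lt)))
                   (ℕ.≤-reflexive (sym (count-yes xs)))

    -- No part exceeds k, so the parts equal to k come first.
    count-top : ∀ {k} xs → Linked _≥_ xs → nth xs 0 ≤ k → ∀ j → j < count k xs → nth xs j ≡ k
    count-top {k} (x ∷ xs) lk le j lt with x ≟ k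
    count-top {k} (x ∷ xs) lk le zero    lt | yes eq   = eq
    count-top {k} (x ∷ xs) lk le (suc j) lt | yes refl =
      count-top xs (linked-tail lk) (nth-antitone lk 0) j
        (ℕ.≤-pred (ℕ.<-≤-trans lt (ℕ.≤-reflexive (count-yes xs))))
    count-top {k} (x ∷ xs) lk le j       lt | no ≢k =
      ⊥-elim (ℕ.<⇒≱ (ℕ.≤∧≢⇒< le ≢k) (ℕ.≤-trans (ℕ.≤-reflexive (sym
        (count-top xs (linked-tail lk) (ℕ.≤-trans (nth-antitone lk 0) le) 0
          (ℕ.≤-<-trans z≤n (ℕ.<-≤-trans lt (ℕ.≤-reflexive (count-no xs ≢k)))))))
        (nth-antitone lk 0)))

    run-count : ∀ {k} xs → Linked _≥_ xs → ∃ λ a → ∀ j → j < count k xs → nth xs (a + j) ≡ k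
    run-count []           lk = 0 , λ j ()
    run-count {k} (x ∷ xs) lk with x ≤? k
    ... | yes le = 0 , count-top (x ∷ xs) lk le
    ... | no ≰ with a , run ← run-count {k} xs (linked-tail lk) =
      suc a , λ j lt → run j (ℕ.<-≤-trans lt (ℕ.≤-reflexive
        (count-no xs λ eq → ≰ (ℕ.≤-reflexive eq))))

  linked : ∀ μ → Linked _≥_ (parts μ)
  linked ⟨ xs , p ⟩ = proj₁ (recompute (linked? ℕ._≥?_ xs ×-dec All.all? (0 <?_) xs) p)

  regular⇒reg : ∀ μ → IsRegular ℓ μ → Reg μ
  regular⇒reg μ regular a pos = ℕ.≰⇒> λ le → ℕ.<⇒≱ (regular (row μ (a + e)))
    (count-run (row μ (a + e)) ℓ a (parts μ) pos λ j lt → ℕ.≤-antisym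
      (ℕ.≤-trans (row-≤ μ (ℕ.m≤m+n a j)) le)
      (row-≤ μ (ℕ.+-monoʳ-≤ a (ℕ.≤-pred lt))))

  reg⇒regular : ∀ μ → Reg μ → IsRegular ℓ μ
  reg⇒regular μ reg zero    = ℕ.≤-<-trans
    (ℕ.≤-reflexive (cong length (filter-none (_≟ 0) (All.map (λ lt eq → ℕ.<⇒≢ lt (sym eq)) (positive μ)))))
    ℕ.z<s
  reg⇒regular μ reg (suc k) = ℕ.≰⇒> λ many →
    let a , run = run-count (parts μ) (linked μ)
        high = subst (λ t → row μ t ≡ suc k) (ℕ.+-identityʳ a) (run 0 (ℕ.<-≤-trans ℕ.z<s many))
        low  = run e many
    in ℕ.<⇒≢ (reg a (subst (0 <_) (sym low) ℕ.z<s)) (trans low (sym high))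

  -- Existence of a last maximum for regular partitions

  private
    best : ∀ (Q : ℕ → Set) → Decidable Q → (h : ℕ → ℤ) → ∀ N →
      (∃ λ n → n ≤ N × Q n × (∀ {m} → m ≤ N → Q m → m < n → h m ℤ.≤ h n) ×
                              (∀ {m} → m ≤ N → Q m → n < m → h m ℤ.< h n)) ⊎
      (∀ {m} → m ≤ N → ¬ Q m)
    best Q Q? h zero with Q? 0
    ... | yes q = inj₁ (0 , z≤n , q , (λ _ _ ()) , λ { z≤n _ () })
    ... | no ¬q = inj₂ λ { z≤n → ¬q }
    best Q Q? h (suc N) with Q? (suc N) | best Q Q? h N
    ... | no ¬q | inj₂ none = inj₂ λ le q → by q (≤∨≡ le)
      where
      by : ∀ {m} → Q m → m ≤ N ⊎ m ≡ suc N → ⊥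
      by q (inj₁ le)   = none le q
      by q (inj₂ refl) = ¬q q
    ... | no ¬q | inj₁ (n , n≤N , q , left , right) = inj₁ (n , ℕ.m≤n⇒m≤1+n n≤N , q ,
      (λ le qm lt → left (ℕ.≤-trans (ℕ.<⇒≤ lt) n≤N) qm lt) ,
      λ le qm lt → by qm lt (≤∨≡ le))
      where
      by : ∀ {m} → Q m → n < m → m ≤ N ⊎ m ≡ suc N → h m ℤ.< h n
      by q lt (inj₁ le)   = right le q lt
      by q lt (inj₂ refl) = ⊥-elim (¬q q)
    ... | yes q | inj₂ none = inj₁ (suc N , ℕ.≤-refl , q ,
      (λ _ qm lt → ⊥-elim (none (ℕ.≤-pred lt) qm)) , λ le _ lt → ⊥-elim (ℕ.<⇒≱ lt le))
    ... | yes q | inj₁ (n , n≤N , qn , left , right) with h n ℤ.≤? h (suc N)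
    -- A tie is decided in favour of the larger index, which makes the maximum a last one.
    ...   | yes le = inj₁ (suc N , ℕ.≤-refl , q ,
      (λ _ qm lt → ℤ.≤-trans (below (ℕ.≤-pred lt) qm) le) , λ le _ lt → ⊥-elim (ℕ.<⇒≱ lt le))
      where
      below : ∀ {m} → m ≤ N → Q m → h m ℤ.≤ h n
      below {m} m≤N qm with ℕ.<-cmp m n
      ... | tri< lt _ _   = left m≤N qm lt
      ... | tri≈ _ refl _ = ℤ.≤-refl
      ... | tri> _ _ lt   = ℤ.<⇒≤ (right m≤N qm lt)
    ...   | no ≰  = inj₁ (n , ℕ.m≤n⇒m≤1+n n≤N , qn ,
      (λ _ qm lt → left (ℕ.≤-trans (ℕ.<⇒≤ lt) n≤N) qm lt) ,
      λ le qm lt → by qm lt (≤∨≡ le))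
      where
      by : ∀ {m} → Q m → n < m → m ≤ N ⊎ m ≡ suc N → h m ℤ.< h n
      by qm lt (inj₁ le)   = right le qm lt
      by qm lt (inj₂ refl) = ℤ.≰⇒> ≰

    color-multiple : ∀ k r → color (r + k * ℓ) ≡ color r
    color-multiple zero    r = cong color (ℕ.+-identityʳ r)
    color-multiple (suc k) r = trans (cong color (shuffle r k d))
      (trans (color-+ℓ (r + k * ℓ)) (color-multiple k r))
      where
      shuffle : ∀ r k d → r + suc k * suc (suc d) ≡ r + k * suc (suc d) + suc (suc d)
      shuffle = ℕ-Solver.solve-∀

  -- No ladder of the same residue precedes r, so no - is counted.
  T-start : ∀ {i r} μ → color r ≡ i → r < ℓ → 0ℤ ℤ.≤ T i r μ
  T-start {i} {r} μ c r<ℓ = subst (ℤ._≤ T i r μ)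
    (∑-zero {f = λ _ → 0ℤ} (All.tabulate {xs = marks ℓ i μ} λ _ → refl))
    (∑-mono (All.map (λ {s} → term s) (marks-marked i μ)))
    where
    term : ∀ s → Marked i μ s → 0ℤ ℤ.≤ val r s
    term (plus x)  _        = subst (0ℤ ℤ.≤_) (sym (ℤ.*-identityʳ _)) (ind-nonneg (lad x ≤? r))
    term (minus x) (cx , _) = ℤ.≤-reflexive (sym (val-out (minus x) λ lt →
      ℕ.<⇒≱ r<ℓ (ℕ.≤-trans (ℕ.m≤n+m ℓ (lad x)) (color-gap (trans cx (sym c)) lt))))

  -- Heights beyond n₀ are smaller, so the search is finite. The maximum is not negative, as it is
  -- at least the height on the first ladder of the residue, `n % ℓ`.
  lastMax-from : ∀ {i n₀} μ → color n₀ ≡ i →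
    (∀ {m} → color m ≡ i → n₀ < m → T i m μ ℤ.< T i n₀ μ) → ∃ λ n → LastMax i n μ
  lastMax-from {i} {n₀} μ c₀ beyond
    with best (λ m → color m ≡ i) (λ m → color m Fin.≟ i) (λ m → T i m μ) n₀
  ... | inj₂ none = ⊥-elim (none ℕ.≤-refl c₀)
  ... | inj₁ (n , n≤n₀ , c , left , right) = n , record
    { onto = c ; nonneg = nonneg
    ; left = left′ ; right = λ {m} cm lt → right′ cm lt (m ≤? n₀) }
    where
    left′ : ∀ {m} → color m ≡ i → m < n → T i m μ ℤ.≤ T i n μ
    left′ cm lt = left (ℕ.≤-trans (ℕ.<⇒≤ lt) n≤n₀) cm lt
    n₀≤ : T i n₀ μ ℤ.≤ T i n μ
    n₀≤ with ℕ.m≤n⇒m<n∨m≡n n≤n₀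
    ... | inj₁ lt   = ℤ.<⇒≤ (right ℕ.≤-refl c₀ lt)
    ... | inj₂ refl = ℤ.≤-refl
    right′ : ∀ {m} → color m ≡ i → n < m → Dec (m ≤ n₀) → T i m μ ℤ.< T i n μ
    right′ cm lt (yes le) = right le cm lt
    right′ cm lt (no ≰)   = ℤ.<-≤-trans (beyond cm (ℕ.≰⇒> ≰)) n₀≤
    r = n % ℓ
    n≡ : n ≡ r + n / ℓ * ℓ
    n≡ = m≡m%n+[m/n]*n n ℓ
    cr : color r ≡ i
    cr = trans (sym (color-multiple (n / ℓ) r)) (trans (cong color (sym n≡)) c)
    r≤n : r ≤ n
    r≤n = ℕ.≤-trans (ℕ.m≤m+n r _) (ℕ.≤-reflexive (sym n≡))
    nonneg : 0ℤ ℤ.≤ T i n μ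
    nonneg with ℕ.m≤n⇒m<n∨m≡n r≤n
    ... | inj₁ lt = ℤ.≤-trans (T-start μ cr (m%n<n n ℓ)) (left′ cr lt)
    ... | inj₂ eq = subst (λ m → 0ℤ ℤ.≤ T i m μ) eq (T-start μ cr (m%n<n n ℓ))

  top-corner : ∀ μ k → row μ k < row μ 0 →
               ∃ λ c → c < k × row μ c ≡ row μ 0 × row μ (suc c) < row μ 0
  top-corner μ zero    lt = ⊥-elim (ℕ.<-irrefl refl lt)
  top-corner μ (suc k) lt with row μ k <? row μ 0
  ... | yes lt′ with c , c<k , eq , drop ← top-corner μ k lt′ = c , ℕ.m<n⇒m<1+n c<k , eq , drop
  ... | no ≮    = k , ℕ.≤-refl , ℕ.≤-antisym (row-≤ μ z≤n) (ℕ.≮⇒≥ ≮) , lt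

  reg-drop : ∀ {μ} → Reg μ → 0 < row μ 0 → ∀ r → row μ e ≡ r → row μ e < row μ 0
  reg-drop {μ} reg pos zero    eq = subst (_< row μ 0) (sym eq) pos
  reg-drop     reg pos (suc _) eq = reg 0 (subst (0 <_) (sym eq) ℕ.z<s)

  -- The reduced signature of a nonempty regular partition contains a − for the
  -- residue of its topmost removable box, since no + follows that box.
  reg-lastMax : ∀ {μ} → Reg μ → 0 < row μ 0 → ∃₂ λ i n → LastMax i n μ
  reg-lastMax {μ} reg pos
    with b , row₀ ← pos⇒suc pos
    with c , c<e , row-c , drop ← top-corner μ e (reg-drop {μ} reg pos (row μ e) refl)
    = color n₀ , lastMax-from μ refl beyond
    where
    n₀ = lad (c , b)
    i = color n₀
    corner : Marked i μ (minus (c , b))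
    corner = refl , sym (trans row-c row₀) , ℕ.≤-pred (ℕ.<-≤-trans drop (ℕ.≤-reflexive row₀))

    -- Rows 0 to c are equally long, so of the rows above c only row 0 has an addable end. It lies e
    -- - c ladders beyond n₀, and 0 < e - c < ℓ gives it another residue.
    no-plus-above : ∀ a h → color (lad (a , h)) ≡ i → AddCriterion μ (a , h) → a < c → ⊥
    no-plus-above zero h ch (refl , _) a<c = color-near {n₀} (e ℕ.∸ c) (ℕ.m<n⇒0<n∸m c<e)
      (s≤s (ℕ.m∸n≤m e c)) (trans (cong color (begin
        c + e * b + (e ℕ.∸ c)    ≡⟨ swap c (e * b) (e ℕ.∸ c) ⟩
        c + (e ℕ.∸ c) + e * b    ≡⟨ cong (_+ e * b) (ℕ.m+[n∸m]≡n (ℕ.<⇒≤ c<e)) ⟩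
        e + e * b                ≡⟨ ℕ.*-suc e b ⟨
        e * suc b                ≡⟨ cong (_*_ e) row₀ ⟨
        e * row μ 0              ∎)) ch)
      where
      open ≡-Reasoning
      swap : ∀ a b c → a + b + c ≡ a + c + b
      swap = ℕ-Solver.solve-∀
    no-plus-above (suc a) h ch (refl , above) a<c = ℕ.<⇒≱ (above a refl)
      (ℕ.≤-trans (row-≤ μ z≤n) (ℕ.≤-trans (ℕ.≤-reflexive (sym row-c)) (row-≤ μ (ℕ.<⇒≤ a<c))))

    beyond : ∀ {m} → color m ≡ i → n₀ < m → T i m μ ℤ.< T i n₀ μ
    -- Every + of the residue lies on a ladder up to n₀, so beyond n₀ only - are added to the count,
    -- among them the corner itself.
    beyond {m} cm n₀<m = ∑-mono-< (All.map (λ {s} → term s) (marks-marked i μ))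
      (∈-marks {i} {μ} {minus (c , b)} corner)
      (subst₂ ℤ._<_ (sym (val-in (minus (c , b)) n₀<m))
        (sym (val-out (minus (c , b)) (ℕ.<-irrefl refl))) ℤ.-<+)
      where
      term : ∀ s → Marked i μ s → val m s ℤ.≤ val n₀ s
      term s@(plus (a , h)) ms@(ch , add-s) with c ≤? a
      ... | no ≰   = ⊥-elim (no-plus-above a h ch add-s (ℕ.≰⇒> ≰))
      ... | yes le = ℤ.≤-reflexive (trans (val-in s (ℕ.≤-trans low (ℕ.<⇒≤ n₀<m)))
                       (sym (val-in s low)))
        where
        low : lad (a , h) ≤ n₀
        low = reg-upwards i {μ} reg s (minus (c , b)) ms corner le
      term s@(minus x) _ = by (lad x <? n₀)
        where
        by : Dec (lad x < n₀) → val m s ℤ.≤ val n₀ s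
        by (yes lt) = ℤ.≤-reflexive (trans (val-in s (ℕ.<-trans lt n₀<m)) (sym (val-in s lt)))
        by (no ≮)   = subst (val m s ℤ.≤_) (sym (val-out s ≮))
          (subst (ℤ._≤ 0ℤ) (sym (neg (ind (lad x <? m)))) (ℤ.neg-mono-≤ (ind-nonneg (lad x <? m))))
          where
          neg : ∀ t → t ℤ.* -1ℤ ≡ ℤ.- t
          neg t = trans (ℤ.*-comm t -1ℤ) (ℤ.-1*i≡-i t)

  -- The two models and the isomorphism

  classical ladderModel : Model
  classical = record
    { Class = Reg ; word = signature ℓ
    ; word-↭ = λ i μ → ↭-reverse (marks ℓ i μ)
    ; _⊑_ = flip _≤_ ; ⊑-refl = ℕ.≤-refl
    ; sorted  = λ i reg → AllPairs.map proj₁ (signature-ordered i reg)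
    ; by-rows = λ i reg → AllPairs.map proj₂ (signature-ordered i reg)
    ; class-∅ = reg-∅
    ; class-grow = λ reg g extreme _ → reg-grow g reg extreme
    ; class-shrink = λ reg g extreme _ → reg-shrink g reg extreme
    ; class-unique = reg-unique
    }
  ladderModel = record
    { Class = HookFree ; word = ladderSignature ℓ
    ; word-↭ = λ i μ → ladderSignature-↭ i
    ; _⊑_ = _≤_ ; ⊑-refl = ℕ.≤-refl
    ; sorted  = λ i free → AllPairs.map proj₁ (ladderSignature-ordered i free)
    ; by-rows = λ i free → AllPairs.map proj₂ (ladderSignature-ordered i free)
    ; class-∅ = hookFree-∅
    ; class-grow = λ free g extreme balance → hookFree-grow g free extreme balance
    ; class-shrink = λ free g extreme balance → hookFree-shrink g free extreme balance
    ; class-unique = hookFree-unique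
    }

  content-boxsum : ∀ i μ → + content ℓ i μ ≡ boxsum μ (λ m → ind (color m Fin.≟ i))
  content-boxsum i μ = begin
    + content ℓ i μ
      ≡⟨ ∑-length-filter (λ x → residue ℓ x Fin.≟ i) (boxes ℓ μ) ⟩
    ∑ has-residue (boxes ℓ μ)
      ≡⟨ ∑-concatMap has-residue (λ a → map (a ,_) (upTo (row μ a))) (upTo N) ⟩
    ∑ (λ a → ∑ has-residue (map (a ,_) (upTo (row μ a)))) (upTo N)
      ≡⟨ ∑-upTo _ N ⟩
    ∑< N (λ a → ∑ has-residue (map (a ,_) (upTo (row μ a))))
      ≡⟨ ∑<-cong N (λ {a} _ → trans (∑-map has-residue (a ,_) (upTo (row μ a)))
           (trans (∑-upTo _ (row μ a)) (∑<-cong (row μ a) λ {b} _ →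
             cong (λ r → ind (r Fin.≟ i)) (residue-lad (a , b))))) ⟩
    boxsum μ (λ m → ind (color m Fin.≟ i)) ∎
    where
    open ≡-Reasoning
    N = length (parts μ)
    has-residue : Position → ℤ
    has-residue x = ind (residue ℓ x Fin.≟ i)

  weight-cong : ∀ l m → l ∼ m → weight ℓ l ≗ weight ℓ m
  weight-cong l m eq j = cong (ℤ._-_ (Λ₀ ℓ j))
    (foldr-cong {R = _≡_} {S = _≡_} (cong₂ ℤ._+_) refl λ i → cong (ℤ._* α ℓ i j)
      (trans (content-boxsum i l)
        (trans (eq λ m → ind (color m Fin.≟ i)) (sym (content-boxsum i m)))))

  private
    module Regular = Model classical
    module Ladder = Model ladderModel

  generated⇒reachable : ∀ {μ} → Generated Ladder.f μ → Reachable ℓ μ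
  generated⇒reachable start         = empty
  generated⇒reachable (next i g eq) = step i (generated⇒reachable g) eq

  reachable⇒generated : ∀ {μ} → Reachable ℓ μ → Generated Ladder.f μ
  reachable⇒generated empty         = start
  reachable⇒generated (step i r eq) = next i (reachable⇒generated r) eq

  regular⇒generated : ∀ μ → IsRegular ℓ μ → Generated Regular.f μ
  regular⇒generated μ = Regular.generate (λ {m} → reg-lastMax {m}) ∘ regular⇒reg μ

  private
    open Crystal (B⟨Λ₀⟩ ℓ) using (Node; Arrow)
    open Crystal (B⟨Λ₀⟩ᴸ ℓ) using () renaming (Node to Nodeᴸ; Arrow to Arrowᴸ)
    module R⇒L = Transfer classical ladderModel
    module L⇒R = Transfer ladderModel classical

    image : (x : Node) → ∃ λ m → Generated Ladder.f m × proj₁ x ∼ m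
    image x = R⇒L.generated-transfer {proj₁ x} (regular⇒generated (proj₁ x) (proj₂ x))

    to : Node → Nodeᴸ
    to x = proj₁ (image x) , generated⇒reachable (proj₁ (proj₂ (image x)))

    to-∼ : ∀ x → proj₁ x ∼ proj₁ (to x)
    to-∼ x = proj₂ (proj₂ (image x))

    R-class : (x : Node) → Reg (proj₁ x)
    R-class x = regular⇒reg (proj₁ x) (proj₂ x)

    L-class : (y : Nodeᴸ) → HookFree (proj₁ y)
    L-class y = Ladder.generated-class (reachable⇒generated (proj₂ y))

    R-injective : ∀ {l} → Reg l → (x : Node) → l ∼ proj₁ x → l ≡ proj₁ x
    R-injective {l} reg x = Regular.∼-injective {l} reg (regular⇒generated (proj₁ x) (proj₂ x))

    L-injective : ∀ {l} → HookFree l → (y : Nodeᴸ) → l ∼ proj₁ y → l ≡ proj₁ y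
    L-injective {l} free y = Ladder.∼-injective {l} free (reachable⇒generated (proj₂ y))

    -- The image is computed from a proof of regularity; that equal partitions have equal images is
    -- again a matter of equal box numbers on the ladders.
    to-cong : ∀ x y → proj₁ x ≡ proj₁ y → proj₁ (to x) ≡ proj₁ (to y)
    to-cong x y eq = L-injective (L-class (to x)) (to y) λ H →
      trans (sym (to-∼ x H)) (trans (cong (λ μ → boxsum μ H) eq) (to-∼ y H))

    to-injective : ∀ x y → proj₁ (to x) ≡ proj₁ (to y) → proj₁ x ≡ proj₁ y
    to-injective x y eq = R-injective (R-class x) y λ H →
      trans (to-∼ x H) (trans (cong (λ μ → boxsum μ H) eq) (sym (to-∼ y H)))

    to-surjective : ∀ y → ∃ λ x → ∀ {z} → proj₁ z ≡ proj₁ x → proj₁ (to z) ≡ proj₁ y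
    to-surjective y =
      let l , gl , eq = L⇒R.generated-transfer (reachable⇒generated (proj₂ y))
          x : Node
          x = l , reg⇒regular l (Regular.generated-class gl)
      in x , λ {z} z≡ →
           L-injective (L-class (to z)) y λ H →
             trans (sym (to-∼ z H)) (trans (cong (λ μ → boxsum μ H) z≡) (sym (eq H)))

    forth : ∀ i x y → Arrow i x y → Arrowᴸ i (to x) (to y)
    forth i x y arrow =
      let m , arrowᴸ , eq = R⇒L.f-transfer {i} {proj₁ x} {proj₁ (to x)} {proj₁ y}
            (R-class x) (L-class (to x)) (to-∼ x) arrow
      in trans arrowᴸ (cong just (L-injective
           (Ladder.f-class {i} {proj₁ (to x)} {m} (L-class (to x)) arrowᴸ) (to y) λ H →
             trans (sym (eq H)) (to-∼ y H)))

    back : ∀ i x y → Arrowᴸ i (to x) (to y) → Arrow i x y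
    back i x y arrowᴸ =
      let l , arrow , eq = L⇒R.f-transfer {i} {proj₁ (to x)} {proj₁ x} {proj₁ (to y)}
            (L-class (to x)) (R-class x) (sym ∘ to-∼ x) arrowᴸ
      in trans arrow (cong just (R-injective
           (Regular.f-class {i} {proj₁ x} {l} (R-class x) arrow) y λ H →
             trans (sym (eq H)) (sym (to-∼ y H))))

  isomorphism : Isomorphism ℓ (B⟨Λ₀⟩ ℓ) (B⟨Λ₀⟩ᴸ ℓ)
  isomorphism = record
    { bijection = record
      { to = to
      ; cong = λ {x} {y} → to-cong x y
      ; bijective = (λ {x} {y} → to-injective x y) , to-surjective
      }
    ; arrows = λ i x y → mk⇔ (forth i x y) (back i x y)
    ; weights = λ x j → sym (weight-cong (proj₁ x) (proj₁ (to x)) (to-∼ x) j)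
    }

corollary3p9p1p8 : (ℓ : ℕ) .{{_ : NonZero ℓ}} → 3 ≤ ℓ →
    Isomorphism ℓ (B⟨Λ₀⟩ ℓ) (B⟨Λ₀⟩ᴸ ℓ)
corollary3p9p1p8 (suc (suc d)) _ = Ladders.isomorphism d
corollary3p9p1p8 (suc zero) (s≤s ())
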